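{- Let $f:\mathbb{C}\to\mathbb{C}$ be a holomorphic function. Suppose that for some natural number $n$ there exist $2n+1$ functions $u,v_1,\dots,v_n,w_1,\dots,w_n:\mathbb{C}\to\mathbb{C}$ satisfying: (i) for every $m\in\{1,\dots,n\}$, $\displaystyle\lim_{h\to 0}\frac{v_m(h)}{h}=0$; (ii) for all $(x,h)\in\mathbb{C}\times\mathbb{C}$, $\displaystyle f(x+h)-f(x)=u(h)f'(x)+\sum_{m=1}^n v_m(h)w_m(x)$. Suppose moreover that there exists a summable set $\mathcal{U}$ such that $\{f,f',w_1,\dots,w_n\}\subset\mathbf{S}(\mathcal{U})$. Then, for all $x\in\mathbb{C}$, $$\frac{d}{dx}\,\Sigma_{\mathcal{U}}(f;1,x)=\mathrm{ess}(f)+\Sigma_{\mathcal{U}}(f';1,x),$$ where $\mathrm{ess}(f)$ is the essence of $f$ relative to $\mathcal{U}$.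
   Context: Sets of functions. $\mathbb{C}^{\mathbb{C}}$ is the set of all functions $\mathbb{C}\to\mathbb{C}$. For $X\subset\mathbb{C}^{\mathbb{C}}$: $\mathbf{L}(X)$ is the set of all (finite, complex) linear combinations of functions in $X$; $\mathbf{T}(X)$ is the set of all translates $x\mapsto g(x+c)$ with $g\in X$, $c\in\mathbb{C}$; and $\mathbf{S}(X):=\mathbf{L}(\mathbf{T}(X))$. Polynomial sums. For a complex polynomial $p$, let $P$ be the unique polynomial with $P(z)-P(z-1)=p(z)$ for all $z$ and $P(0)=0$; the fractional sum of $p$ from $x$ to $y$ is $P(y)-P(x-1)$, for $x,y\in\mathbb{C}$. Fractional summable functions. $f:\mathbb{C}\to\mathbb{C}$ is fractional summable if there are a degree bound $m$ and a sequence $(p_n)_{n\in\mathbb{N}}$ of polynomials of degree $\le m$ (the null polynomial has degree $-\infty$) such that $|f(n+x)-p_n(n+x)|\to 0$ as $n\to\infty$ for all $x\in\mathbb{C}$, and such that for all $x,y\in\mathbb{C}$ the limit as $n\to\infty$ of (fractional sum of $p_n$ from $n+x$ to $n+y$) $+\sum_{\nu=1}^n\bigl(f(\nu+x-1)-f(\nu+y)\bigr)$ exists. $\mathcal{F}$ is the set of functions $\mathbb{C}\to\mathbb{C}$ that are linear combinations of holomorphic (entire) functions and fractional summable functions. Summable sets. A set $\mathcal{U}\subset\mathcal{F}$ is a summable set if there is a unique map $\Sigma_{\mathcal{U}}:\mathbf{S}(\mathcal{U})\times\mathbb{C}^2\to\mathbb{C}$, $(f,x,y)\mapsto\Sigma_{\mathcal{U}}(f;x,y)$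 (thought of as "$\sum_{k=x}^y f(k)$"), satisfying, for all $f,g\in\mathbf{S}(\mathcal{U})$ and $x,y,z,s,\lambda,\mu\in\mathbb{C}$: (A1) $\Sigma_{\mathcal{U}}(f;x,y)+\Sigma_{\mathcal{U}}(f;y+1,z)=\Sigma_{\mathcal{U}}(f;x,z)$; (A2) $\Sigma_{\mathcal{U}}(f;x+s,y+s)=\Sigma_{\mathcal{U}}(h;x,y)$ where $h(t)=f(t+s)$; (A3) $\Sigma_{\mathcal{U}}(\lambda f+\mu g;x,y)=\lambda\Sigma_{\mathcal{U}}(f;x,y)+\mu\Sigma_{\mathcal{U}}(g;x,y)$; (A4) $\Sigma_{\mathcal{U}}(f;1,1)=f(1)$; (A5*) if $f$ is holomorphic, then $x\mapsto\Sigma_{\mathcal{U}}(f;1,x)$ is holomorphic on $\mathbb{C}$; (A6) if $\lim_{n\to\infty}f(t+n)=0$ for every $t\in\mathbb{C}$, then $\lim_{n\to\infty}\Sigma_{\mathcal{U}}(f(\cdot+n);x,y)=0$; moreover, if there is a sequence $(p_n)$ of polynomials of fixed degree (independent of $n$) with $|f(t+n)-p_n(t+n)|\to0$ for all $t\in\mathbb{C}$, then $\Sigma_{\mathcal{U}}(f(\cdot+n);x,y)$ minus the fractional sum of the polynomial $p_n(\cdot+n)$ from $x$ to $y$ tends to $0$ as $n\to\infty$. The map $\Sigma_{\mathcal{U}}$ is called the fractional sum relative to $\mathcal{U}$. Essence. For $f\in\mathbf{S}(\mathcal{U})$, the essence of $f$ relative to $\mathcal{U}$ is $\mathrm{ess}(f):=\lim_{h\to0}\frac1h\Sigma_{\mathcal{U}}(f;1,h)$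 ($h\in\mathbb{C}\setminus\{0\}$), if the limit exists; then $f$ is said to be a function with essence in $\mathcal{U}$. -}

module Defs where

open import Algebra.Bundles using (CommutativeRing)
import Algebra.Definitions.RawMonoid as RawMonoid
import Algebra.Solver.Ring.NaturalCoefficients.Default as NatSolver
open import Data.Fin.Base using (Fin; toℕ)
open import Data.List.Base using (List; []; _∷_; _++_; map)
open import Data.Nat.Base as ℕ using (ℕ; zero; suc)
import Data.Nat.Properties as ℕ
open import Data.Product.Base using (∃; ∃-syntax; _×_; _,_; proj₁; proj₂)
open import Data.Product.Relation.Binary.Pointwise.NonDependent using (_×ₛ_)
open import Data.Rational.Base as ℚ using (ℚ; 0ℚ; 1ℚ)
import Data.Rational.Properties as ℚ
open import Data.Rational.Solver using (module +-*-Solver)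
open import Function.Bundles using (Func; _⟨$⟩_)
open import Function.Relation.Binary.Setoid.Equality using (_⇨_)
open import Level using (0ℓ)
open import Relation.Binary.Bundles using (Setoid)
import Relation.Binary.Construct.On as On
open import Relation.Binary.PropositionalEquality as ≡ using (_≡_)
import Relation.Binary.Reasoning.Setoid as SetoidReasoning
open import Relation.Nullary.Construct.Add.Infimum using (_₋; ⊥₋; [_])
open import Relation.Unary using (Pred; _∈_; _∪_; _⊆_)

module Rat where

  open import Data.Rational.Base
  open +-*-Solver

  Eventually : (ℕ → Set) → Set
  Eventually P = ∃[ N ] ∀ n → N ℕ.≤ n → P n

  both : ∀ {P Q R : ℕ → Set} → (∀ n → P n → Q n → R n) →
         Eventually P → Eventually Q → Eventually R
  both f (M , p) (N , q) = M ℕ.⊔ N , λ n n≥ →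
    f n (p n (ℕ.≤-trans (ℕ.m≤m⊔n M N) n≥)) (q n (ℕ.≤-trans (ℕ.m≤n⊔m M N) n≥))

  0<+ : ∀ {p q} → 0ℚ < p → 0ℚ < q → 0ℚ < p + q
  0<+ = ℚ.+-mono-<

  0<* : ∀ {p q} → 0ℚ < p → 0ℚ < q → 0ℚ < p * q
  0<* {p} {q} 0<p 0<q =
    ≡.subst (_< p * q) (ℚ.*-zeroˡ q) (ℚ.*-monoˡ-<-pos q {{positive 0<q}} 0<p)

  <-+ʳ : ∀ {p b c} → p < b → 0ℚ < c → p < b + c
  <-+ʳ {p} {b} {c} p<b 0<c =
    ≡.subst (_< b + c) (ℚ.+-identityʳ p) (ℚ.+-mono-< p<b 0<c)

  <-+ˡ : ∀ {p b c} → p < c → 0ℚ < b → p < b + c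
  <-+ˡ {p} {b} {c} p<c 0<b =
    ≡.subst (_< b + c) (ℚ.+-identityˡ p) (ℚ.+-mono-< 0<b p<c)

  inv : ∀ p → 0ℚ < p → ℚ
  inv p 0<p = 1/_ p {{>-nonZero 0<p}}

  inv-inverse : ∀ p (0<p : 0ℚ < p) → p * inv p 0<p ≡ 1ℚ
  inv-inverse p 0<p = ℚ.*-inverseʳ p {{>-nonZero 0<p}}

  0<inv : ∀ p (0<p : 0ℚ < p) → 0ℚ < inv p 0<p
  0<inv p 0<p = ℚ.positive⁻¹ (inv p 0<p) {{ℚ.1/pos⇒pos p {{positive 0<p}}}}

  abstract

    ½ε : ∀ {ε} → 0ℚ < ε → 0ℚ < ε * ½
    ½ε 0<ε = 0<* 0<ε (ℚ.positive⁻¹ ½)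

    halves : ∀ ε → ε * ½ + ε * ½ ≡ ε
    halves ε = ≡.trans (≡.sym (ℚ.*-distribˡ-+ ε ½ ½)) (ℚ.*-identityʳ ε)

    distance-sym : ∀ p q → ∣ p - q ∣ ≡ ∣ q - p ∣
    distance-sym p q = ≡.trans
      (≡.cong ∣_∣ (solve 2 (λ p q → p :+ :- q := :- (q :+ :- p)) ≡.refl p q))
      (ℚ.∣-p∣≡∣p∣ (q - p))

    ∣+∣< : ∀ {p q δ ε} → ∣ p ∣ < δ → ∣ q ∣ < ε → ∣ p + q ∣ < δ + ε
    ∣+∣< {p} {q} p<δ q<ε = ℚ.≤-<-trans (ℚ.∣p+q∣≤∣p∣+∣q∣ p q) (ℚ.+-mono-< p<δ q<ε)

    triangle : ∀ p q r {ε} → ∣ p - q ∣ < ε * ½ → ∣ q - r ∣ < ε * ½ → ∣ p - r ∣ < ε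
    triangle p q r {ε} pq qr = ≡.subst₂ (λ a b → ∣ a ∣ < b)
      (solve 3 (λ p q r → (p :+ :- q) :+ (q :+ :- r) := p :+ :- r) ≡.refl p q r)
      (halves ε) (∣+∣< pq qr)

    +-close : ∀ p q r s {ε} → ∣ p - q ∣ < ε * ½ → ∣ r - s ∣ < ε * ½ →
              ∣ (p + r) - (q + s) ∣ < ε
    +-close p q r s {ε} pq rs = ≡.subst₂ (λ a b → ∣ a ∣ < b)
      (solve 4 (λ p q r s → (p :+ :- q) :+ (r :+ :- s) := (p :+ r) :+ :- (q :+ s))
        ≡.refl p q r s)
      (halves ε) (∣+∣< pq rs)

    -‿close : ∀ p q {ε} → ∣ p - q ∣ < ε → ∣ (- p) - (- q) ∣ < ε
    -‿close p q = ≡.subst (_< _) (≡.trans (≡.sym (ℚ.∣-p∣≡∣p∣ (p - q)))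
      (≡.cong ∣_∣ (solve 2 (λ p q → :- (p :+ :- q) := :- p :+ :- (:- q)) ≡.refl p q)))

    ∣*∣< : ∀ p q {B δ} → 0ℚ < δ → ∣ p ∣ < B → ∣ q ∣ < δ → ∣ p * q ∣ < B * δ
    ∣*∣< p q {B} {δ} 0<δ p<B q<δ = ≡.subst (_< B * δ) (≡.sym (ℚ.∣p*q∣≡∣p∣*∣q∣ p q))
      (ℚ.≤-<-trans
        (ℚ.*-monoˡ-≤-nonNeg ∣ p ∣ {{nonNegative (ℚ.0≤∣p∣ p)}} (ℚ.<⇒≤ q<δ))
        (ℚ.*-monoˡ-<-pos δ {{positive 0<δ}} p<B))

    -- If p and s are bounded by B, then p r and q s are ε-close as soon as
    -- p, q and r, s are δ-close.
    *-close : ∀ B ε → 0ℚ < B → 0ℚ < ε → ∃[ δ ] 0ℚ < δ × (∀ p q r s →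
              ∣ p ∣ < B → ∣ s ∣ < B → ∣ p - q ∣ < δ → ∣ r - s ∣ < δ →
              ∣ p * r - q * s ∣ < ε)
    *-close B ε 0<B 0<ε = δ , 0<δ , λ p q r s p<B s<B pq rs →
      ≡.subst₂ (λ a b → ∣ a ∣ < b)
        (solve 4 (λ p q r s → p :* (r :+ :- s) :+ s :* (p :+ :- q) :=
                              p :* r :+ :- (q :* s)) ≡.refl p q r s)
        sum≡ε
        (∣+∣< (∣*∣< p (r - s) 0<δ p<B rs) (∣*∣< s (p - q) 0<δ s<B pq))
      where
      δ : ℚ
      δ = (ε * ½) * inv B 0<B
      0<δ : 0ℚ < δ
      0<δ = 0<* (½ε 0<ε) (0<inv B 0<B)
      sum≡ε : B * δ + B * δ ≡ ε
      sum≡ε = ≡.trans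
        (solve 3 (λ B e i → B :* (e :* i) :+ B :* (e :* i) := (B :* i) :* (e :+ e))
          ≡.refl B (ε * ½) (inv B 0<B))
        (≡.trans (≡.cong₂ _*_ (inv-inverse B 0<B) (halves ε)) (ℚ.*-identityˡ ε))

    inv≤ : ∀ p q (0<p : 0ℚ < p) (0<q : 0ℚ < q) → q ≤ p → inv p 0<p ≤ inv q 0<q
    inv≤ p q 0<p 0<q q≤p = ≡.subst₂ _≤_
      (≡.trans (solve 3 (λ i j q → q :* (i :* j) := i :* (q :* j)) ≡.refl i j q)
               (≡.trans (≡.cong (i *_) (inv-inverse q 0<q)) (ℚ.*-identityʳ i)))
      (≡.trans (solve 3 (λ i j p → p :* (i :* j) := (p :* i) :* j) ≡.refl i j p)
               (≡.trans (≡.cong (_* j) (inv-inverse p 0<p)) (ℚ.*-identityˡ j)))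
      (ℚ.*-monoʳ-≤-nonNeg (i * j)
        {{nonNegative (ℚ.<⇒≤ (0<* (0<inv p 0<p) (0<inv q 0<q)))}} q≤p)
      where
      i j : ℚ
      i = inv p 0<p
      j = inv q 0<q

    inv-close : ∀ q ε → 0ℚ < q → 0ℚ < ε → ∃[ δ ] 0ℚ < δ × (∀ a b
                (0<a : 0ℚ < a) (0<b : 0ℚ < b) → q ≤ a → q ≤ b →
                ∣ a - b ∣ < δ → ∣ inv a 0<a - inv b 0<b ∣ < ε)
    inv-close q ε 0<q 0<ε = δ , 0<δ , close
      where
      δ : ℚ
      δ = ε * (q * q)
      0<δ : 0ℚ < δ
      0<δ = 0<* 0<ε (0<* 0<q 0<q)
      j : ℚ
      j = inv q 0<q
      close : ∀ a b (0<a : 0ℚ < a) (0<b : 0ℚ < b) → q ≤ a → q ≤ b →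
              ∣ a - b ∣ < δ → ∣ inv a 0<a - inv b 0<b ∣ < ε
      close a b 0<a 0<b q≤a q≤b ab = begin-strict
        ∣ i - k ∣             ≡⟨ ≡.cong ∣_∣ diff ⟩
        ∣ (i * k) * (b - a) ∣  ≡⟨ ℚ.∣p*q∣≡∣p∣*∣q∣ (i * k) (b - a) ⟩
        ∣ i * k ∣ * ∣ b - a ∣   ≡⟨ ≡.cong₂ _*_ (ℚ.0≤p⇒∣p∣≡p (ℚ.<⇒≤ 0<ik)) (distance-sym b a) ⟩
        (i * k) * ∣ a - b ∣    <⟨ ℚ.*-monoʳ-<-pos (i * k) {{positive 0<ik}} ab ⟩
        (i * k) * δ           ≤⟨ ℚ.*-monoʳ-≤-nonNeg δ {{nonNegative (ℚ.<⇒≤ 0<δ)}} ik≤jj ⟩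
        (j * j) * δ           ≡⟨ solve 3 (λ j e q → (j :* j) :* (e :* (q :* q)) :=
                                   ((q :* j) :* (q :* j)) :* e) ≡.refl j ε q ⟩
        ((q * j) * (q * j)) * ε ≡⟨ ≡.cong (λ t → (t * t) * ε) (inv-inverse q 0<q) ⟩
        (1ℚ * 1ℚ) * ε         ≡⟨ ℚ.*-identityˡ ε ⟩
        ε                     ∎
        where
        open ℚ.≤-Reasoning
        i k : ℚ
        i = inv a 0<a
        k = inv b 0<b
        0<ik : 0ℚ < i * k
        0<ik = 0<* (0<inv a 0<a) (0<inv b 0<b)
        diff : i - k ≡ (i * k) * (b - a)
        diff = ≡.trans
          (≡.cong₂ (λ s t → s - t)
            (≡.sym (≡.trans (≡.cong (i *_) (inv-inverse b 0<b)) (ℚ.*-identityʳ i)))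
            (≡.sym (≡.trans (≡.cong (k *_) (inv-inverse a 0<a)) (ℚ.*-identityʳ k))))
          (solve 4 (λ i k a b → i :* (b :* k) :+ :- (k :* (a :* i)) :=
                     (i :* k) :* (b :+ :- a)) ≡.refl i k a b)
        ik≤jj : i * k ≤ j * j
        ik≤jj = ℚ.≤-trans
          (ℚ.*-monoʳ-≤-nonNeg k {{nonNegative (ℚ.<⇒≤ (0<inv b 0<b))}} (inv≤ a q 0<a 0<q q≤a))
          (ℚ.*-monoˡ-≤-nonNeg j {{nonNegative (ℚ.<⇒≤ (0<inv q 0<q))}} (inv≤ b q 0<b 0<q q≤b))

module Real where

  open Rat

  record ℝ : Set where
    no-eta-equality
    constructor mkℝ
    field
      seq    : ℕ → ℚ
      cauchy : ∀ ε → 0ℚ ℚ.< ε →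
               ∃[ N ] ∀ m n → N ℕ.≤ m → N ℕ.≤ n → ℚ.∣ seq m ℚ.- seq n ∣ ℚ.< ε
  open ℝ public

  infix 4 _≈_ _<_
  infixl 6 _+_
  infixl 7 _*_
  infix 8 -_

  record _≈_ (x y : ℝ) : Set where
    constructor mk≈
    field
      close : ∀ ε → 0ℚ ℚ.< ε → Eventually (λ n → ℚ.∣ seq x n ℚ.- seq y n ∣ ℚ.< ε)
  open _≈_ public

  record _<_ (x y : ℝ) : Set where
    constructor mk<
    field
      gap       : ℚ
      0<gap     : 0ℚ ℚ.< gap
      separated : Eventually (λ n → seq x n ℚ.+ gap ℚ.≤ seq y n)
  open _<_ public

  ≈-refl : ∀ {x} → x ≈ x
  ≈-refl {x} .close ε 0<ε = 0 , λ n _ →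
    ≡.subst (λ a → ℚ.∣ a ∣ ℚ.< ε) (≡.sym (ℚ.+-inverseʳ (seq x n))) 0<ε

  ≗⇒≈ : ∀ {x y} → (∀ n → seq x n ≡ seq y n) → x ≈ y
  ≗⇒≈ {x} {y} x≗y .close ε 0<ε = 0 , λ n _ → ≡.subst (λ a → ℚ.∣ a ∣ ℚ.< ε)
    (≡.trans (≡.sym (ℚ.+-inverseʳ (seq x n))) (≡.cong (λ a → seq x n ℚ.- a) (x≗y n))) 0<ε

  ≈-sym : ∀ {x y} → x ≈ y → y ≈ x
  ≈-sym {x} {y} x≈y .close ε 0<ε with close x≈y ε 0<ε
  ... | N , c = N , λ n n≥ →
    ≡.subst (ℚ._< ε) (distance-sym (seq x n) (seq y n)) (c n n≥)

  ≈-trans : ∀ {x y z} → x ≈ y → y ≈ z → x ≈ z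
  ≈-trans {x} {y} {z} x≈y y≈z .close ε 0<ε =
    both (λ n → triangle (seq x n) (seq y n) (seq z n))
      (close x≈y (ε ℚ.* ℚ.½) (½ε 0<ε)) (close y≈z (ε ℚ.* ℚ.½) (½ε 0<ε))

  fromℚ : ℚ → ℝ
  fromℚ q .seq _ = q
  fromℚ q .cauchy ε 0<ε = 0 , λ _ _ _ _ →
    ≡.subst (λ a → ℚ.∣ a ∣ ℚ.< ε) (≡.sym (ℚ.+-inverseʳ q)) 0<ε

  0ℝ 1ℝ : ℝ
  0ℝ = fromℚ 0ℚ
  1ℝ = fromℚ 1ℚ

  _+_ : ℝ → ℝ → ℝ
  (x + y) .seq n = seq x n ℚ.+ seq y n
  (x + y) .cauchy ε 0<ε
    with cauchy x (ε ℚ.* ℚ.½) (½ε 0<ε) | cauchy y (ε ℚ.* ℚ.½) (½ε 0<ε)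
  ... | M , cx | N , cy = M ℕ.⊔ N , λ m n m≥ n≥ →
    +-close (seq x m) (seq x n) (seq y m) (seq y n)
      (cx m n (ℕ.m⊔n≤o⇒m≤o M N m≥) (ℕ.m⊔n≤o⇒m≤o M N n≥))
      (cy m n (ℕ.m⊔n≤o⇒n≤o M N m≥) (ℕ.m⊔n≤o⇒n≤o M N n≥))

  -_ : ℝ → ℝ
  (- x) .seq n = ℚ.- seq x n
  (- x) .cauchy ε 0<ε with cauchy x ε 0<ε
  ... | N , c = N , λ m n m≥ n≥ → -‿close (seq x m) (seq x n) (c m n m≥ n≥)

  abstract

    bounded : ∀ x → ∃[ B ] 0ℚ ℚ.< B × Eventually (λ n → ℚ.∣ seq x n ∣ ℚ.< B)
    bounded x with cauchy x 1ℚ (ℚ.positive⁻¹ 1ℚ)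
    ... | N , c = 1ℚ ℚ.+ a
                , ℚ.<-≤-trans (ℚ.positive⁻¹ 1ℚ)
                    (≡.subst (ℚ._≤ 1ℚ ℚ.+ a) (ℚ.+-identityʳ 1ℚ) (ℚ.+-monoʳ-≤ 1ℚ (ℚ.0≤∣p∣ (seq x N))))
                , N , λ n n≥ → ≡.subst (λ b → ℚ.∣ b ∣ ℚ.< 1ℚ ℚ.+ a)
                    (solve 2 (λ p q → (p :+ :- q) :+ q := p) ≡.refl (seq x n) (seq x N))
                    (ℚ.≤-<-trans (ℚ.∣p+q∣≤∣p∣+∣q∣ (seq x n ℚ.- seq x N) (seq x N))
                      (ℚ.+-monoˡ-< a (c n N n≥ ℕ.≤-refl)))
      where
      open +-*-Solver
      a : ℚ
      a = ℚ.∣ seq x N ∣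

    bounded₂ : ∀ x y → ∃[ B ] 0ℚ ℚ.< B ×
               Eventually (λ n → ℚ.∣ seq x n ∣ ℚ.< B × ℚ.∣ seq y n ∣ ℚ.< B)
    bounded₂ x y = combine (bounded x) (bounded y)
      where
      combine : ∃[ B ] 0ℚ ℚ.< B × Eventually (λ n → ℚ.∣ seq x n ∣ ℚ.< B) →
                ∃[ C ] 0ℚ ℚ.< C × Eventually (λ n → ℚ.∣ seq y n ∣ ℚ.< C) →
                ∃[ B ] 0ℚ ℚ.< B ×
                  Eventually (λ n → ℚ.∣ seq x n ∣ ℚ.< B × ℚ.∣ seq y n ∣ ℚ.< B)
      combine (B , 0<B , x<B) (C , 0<C , y<C) = B ℚ.+ C , 0<+ 0<B 0<C , both
        (λ n p q → <-+ʳ p 0<C , <-+ˡ q 0<B) x<B y<C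

  _*_ : ℝ → ℝ → ℝ
  (x * y) .seq n = seq x n ℚ.* seq y n
  (x * y) .cauchy ε 0<ε with bounded₂ x y
  ... | B , 0<B , L , xy<B with *-close B ε 0<B 0<ε
  ... | δ , 0<δ , c with cauchy x δ 0<δ | cauchy y δ 0<δ
  ... | M , cx | N , cy = L ℕ.⊔ (M ℕ.⊔ N) , λ m n m≥ n≥ →
    let m≥′ = ℕ.m⊔n≤o⇒n≤o L _ m≥ ; n≥′ = ℕ.m⊔n≤o⇒n≤o L _ n≥ in
    c (seq x m) (seq x n) (seq y m) (seq y n)
      (proj₁ (xy<B m (ℕ.m⊔n≤o⇒m≤o L _ m≥))) (proj₂ (xy<B n (ℕ.m⊔n≤o⇒m≤o L _ n≥)))
      (cx m n (ℕ.m⊔n≤o⇒m≤o M N m≥′) (ℕ.m⊔n≤o⇒m≤o M N n≥′))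
      (cy m n (ℕ.m⊔n≤o⇒n≤o M N m≥′) (ℕ.m⊔n≤o⇒n≤o M N n≥′))

  +-cong : ∀ {x y u v} → x ≈ y → u ≈ v → x + u ≈ y + v
  +-cong {x} {y} {u} {v} x≈y u≈v .close ε 0<ε =
    both (λ n → +-close (seq x n) (seq y n) (seq u n) (seq v n))
      (close x≈y (ε ℚ.* ℚ.½) (½ε 0<ε)) (close u≈v (ε ℚ.* ℚ.½) (½ε 0<ε))

  -‿cong : ∀ {x y} → x ≈ y → - x ≈ - y
  -‿cong {x} {y} x≈y .close ε 0<ε with close x≈y ε 0<ε
  ... | N , c = N , λ n n≥ → -‿close (seq x n) (seq y n) (c n n≥)

  *-cong : ∀ {x y u v} → x ≈ y → u ≈ v → x * u ≈ y * v
  *-cong {x} {y} {u} {v} x≈y u≈v .close ε 0<ε with bounded₂ x v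
  ... | B , 0<B , xv<B with *-close B ε 0<B 0<ε
  ... | δ , 0<δ , c = both (λ n (x<B , v<B) (xy , uv) →
          c (seq x n) (seq y n) (seq u n) (seq v n) x<B v<B xy uv)
          xv<B (both (λ _ → _,_) (close x≈y δ 0<δ) (close u≈v δ 0<δ))

  ℝ-commutativeRing : CommutativeRing 0ℓ 0ℓ
  ℝ-commutativeRing = record
    { Carrier = ℝ ; _≈_ = _≈_ ; _+_ = _+_ ; _*_ = _*_ ; -_ = -_ ; 0# = 0ℝ ; 1# = 1ℝ
    ; isCommutativeRing = record
      { isRing = record
        { +-isAbelianGroup = record
          { isGroup = record
            { isMonoid = record
              { isSemigroup = record
                { isMagma = record
                  { isEquivalence = record { refl = ≈-refl ; sym = ≈-sym ; trans = ≈-trans }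
                  ; ∙-cong = +-cong }
                ; assoc = λ x y z → ≗⇒≈ λ n → ℚ.+-assoc (seq x n) (seq y n) (seq z n) }
              ; identity = (λ x → ≗⇒≈ λ n → ℚ.+-identityˡ (seq x n))
                         , (λ x → ≗⇒≈ λ n → ℚ.+-identityʳ (seq x n)) }
            ; inverse = (λ x → ≗⇒≈ λ n → ℚ.+-inverseˡ (seq x n))
                      , (λ x → ≗⇒≈ λ n → ℚ.+-inverseʳ (seq x n))
            ; ⁻¹-cong = -‿cong }
          ; comm = λ x y → ≗⇒≈ λ n → ℚ.+-comm (seq x n) (seq y n) }
        ; *-cong = *-cong
        ; *-assoc = λ x y z → ≗⇒≈ λ n → ℚ.*-assoc (seq x n) (seq y n) (seq z n)
        ; *-identity = (λ x → ≗⇒≈ λ n → ℚ.*-identityˡ (seq x n))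
                     , (λ x → ≗⇒≈ λ n → ℚ.*-identityʳ (seq x n))
        ; distrib = (λ x y z → ≗⇒≈ λ n → ℚ.*-distribˡ-+ (seq x n) (seq y n) (seq z n))
                  , (λ x y z → ≗⇒≈ λ n → ℚ.*-distribʳ-+ (seq x n) (seq y n) (seq z n)) }
      ; *-comm = λ x y → ≗⇒≈ λ n → ℚ.*-comm (seq x n) (seq y n) } }

  -- Only finitely many terms of x may lie below the gap g witnessing 0 < x;
  -- truncating at g makes every term invertible without changing the limit.
  module _ (x : ℝ) (0<x : 0ℝ < x) where
    private
      g = gap 0<x
      g≤ : Eventually (λ n → g ℚ.≤ seq x n)
      g≤ with separated 0<x
      ... | N , s = N , λ n n≥ → ≡.subst (ℚ._≤ seq x n) (ℚ.+-identityˡ g) (s n n≥)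
      0<⊔ : ∀ n → 0ℚ ℚ.< seq x n ℚ.⊔ g
      0<⊔ n = ℚ.<-≤-trans (0<gap 0<x) (ℚ.p≤q⊔p (seq x n) g)
      ⊔≡ : ∀ {n} → g ℚ.≤ seq x n → seq x n ℚ.⊔ g ≡ seq x n
      ⊔≡ = ℚ.p≥q⇒p⊔q≡p

    recip : ℝ
    recip .seq n = inv (seq x n ℚ.⊔ g) (0<⊔ n)
    recip .cauchy ε 0<ε with inv-close g ε (0<gap 0<x) 0<ε
    ... | δ , 0<δ , c with cauchy x δ 0<δ | g≤
    ... | M , cx | N , g≤x = M ℕ.⊔ N , λ m n m≥ n≥ →
      c _ _ (0<⊔ m) (0<⊔ n) (ℚ.p≤q⊔p (seq x m) g) (ℚ.p≤q⊔p (seq x n) g)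
        (≡.subst₂ (λ a b → ℚ.∣ a ℚ.- b ∣ ℚ.< δ)
          (≡.sym (⊔≡ (g≤x m (ℕ.m⊔n≤o⇒n≤o M N m≥))))
          (≡.sym (⊔≡ (g≤x n (ℕ.m⊔n≤o⇒n≤o M N n≥))))
          (cx m n (ℕ.m⊔n≤o⇒m≤o M N m≥) (ℕ.m⊔n≤o⇒m≤o M N n≥)))

    recip-inverse : x * recip ≈ 1ℝ
    recip-inverse .close ε 0<ε with g≤
    ... | N , g≤x = N , λ n n≥ → ≡.subst (λ a → ℚ.∣ a ∣ ℚ.< ε)
      (≡.trans (≡.sym (ℚ.+-inverseʳ 1ℚ)) (≡.cong (ℚ._- 1ℚ)
        (≡.sym (≡.trans (≡.cong (ℚ._* seq recip n) (≡.sym (⊔≡ (g≤x n n≥))))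
                        (inv-inverse (seq x n ℚ.⊔ g) (0<⊔ n))))))
      0<ε


open Real using (ℝ)

module Complex where

  private
    module R = CommutativeRing Real.ℝ-commutativeRing
  open R using () renaming (_+_ to _+ᴿ_; _*_ to _*ᴿ_; -_ to -ᴿ_; _-_ to _-ᴿ_; _≈_ to _≈ᴿ_)

  record ℂ : Set where
    no-eta-equality
    constructor mkℂ
    field
      re im : ℝ
  open ℂ public

  infix 4 _≈_
  infixl 6 _+_
  infixl 7 _*_
  infix 8 -_

  record _≈_ (z w : ℂ) : Set where
    constructor mk≈
    field
      re≈ : re z ≈ᴿ re w
      im≈ : im z ≈ᴿ im w
  open _≈_ public

  fromℝ : ℝ → ℂ
  fromℝ x .re = x
  fromℝ x .im = R.0#

  0ℂ 1ℂ : ℂ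
  0ℂ = fromℝ R.0#
  1ℂ = fromℝ R.1#

  _+_ _*_ : ℂ → ℂ → ℂ
  (z + w) .re = re z +ᴿ re w
  (z + w) .im = im z +ᴿ im w
  (z * w) .re = re z *ᴿ re w -ᴿ im z *ᴿ im w
  (z * w) .im = re z *ᴿ im w +ᴿ im z *ᴿ re w

  -_ : ℂ → ℂ
  (- z) .re = -ᴿ re z
  (- z) .im = -ᴿ im z

  ≈-refl : ∀ {z} → z ≈ z
  ≈-refl = mk≈ R.refl R.refl

  ≈-sym : ∀ {z w} → z ≈ w → w ≈ z
  ≈-sym z≈w = mk≈ (R.sym (re≈ z≈w)) (R.sym (im≈ z≈w))

  ≈-trans : ∀ {z w v} → z ≈ w → w ≈ v → z ≈ v
  ≈-trans z≈w w≈v = mk≈ (R.trans (re≈ z≈w) (re≈ w≈v)) (R.trans (im≈ z≈w) (im≈ w≈v))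

  +-cong : ∀ {z w u v} → z ≈ w → u ≈ v → z + u ≈ w + v
  +-cong z≈w u≈v = mk≈ (R.+-cong (re≈ z≈w) (re≈ u≈v)) (R.+-cong (im≈ z≈w) (im≈ u≈v))

  *-cong : ∀ {z w u v} → z ≈ w → u ≈ v → z * u ≈ w * v
  *-cong z≈w u≈v = mk≈
    (R.+-cong (R.*-cong (re≈ z≈w) (re≈ u≈v)) (R.-‿cong (R.*-cong (im≈ z≈w) (im≈ u≈v))))
    (R.+-cong (R.*-cong (re≈ z≈w) (im≈ u≈v)) (R.*-cong (im≈ z≈w) (re≈ u≈v)))

  private
    open +-*-Solver
    open Real using (seq; ≗⇒≈)

    *-assoc : ∀ z w v → (z * w) * v ≈ z * (w * v)
    *-assoc z w v = mk≈
      (≗⇒≈ λ n → solve 6 (λ a b c d e f →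
        ((a :* c :+ :- (b :* d)) :* e :+ :- ((a :* d :+ b :* c) :* f)) :=
        (a :* (c :* e :+ :- (d :* f)) :+ :- (b :* (c :* f :+ d :* e))))
        ≡.refl (seq (re z) n) (seq (im z) n) (seq (re w) n) (seq (im w) n)
        (seq (re v) n) (seq (im v) n))
      (≗⇒≈ λ n → solve 6 (λ a b c d e f →
        ((a :* c :+ :- (b :* d)) :* f :+ (a :* d :+ b :* c) :* e) :=
        (a :* (c :* f :+ d :* e) :+ b :* (c :* e :+ :- (d :* f))))
        ≡.refl (seq (re z) n) (seq (im z) n) (seq (re w) n) (seq (im w) n)
        (seq (re v) n) (seq (im v) n))

    *-comm : ∀ z w → z * w ≈ w * z
    *-comm z w = mk≈
      (R.+-cong (R.*-comm (re z) (re w)) (R.-‿cong (R.*-comm (im z) (im w))))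
      (R.trans (R.+-comm (re z *ᴿ im w) (im z *ᴿ re w))
        (R.+-cong (R.*-comm (im z) (re w)) (R.*-comm (re z) (im w))))

    *-identityˡ : ∀ z → 1ℂ * z ≈ z
    *-identityˡ z = mk≈
      (≗⇒≈ λ n → solve 2 (λ a b → con 1ℚ :* a :+ :- (con 0ℚ :* b) := a)
        ≡.refl (seq (re z) n) (seq (im z) n))
      (≗⇒≈ λ n → solve 2 (λ a b → con 1ℚ :* b :+ con 0ℚ :* a := b)
        ≡.refl (seq (re z) n) (seq (im z) n))

    *-distribʳ-+ : ∀ v z w → (z + w) * v ≈ z * v + w * v
    *-distribʳ-+ v z w = mk≈
      (≗⇒≈ λ n → solve 6 (λ a b c d e f →
        ((a :+ c) :* e :+ :- ((b :+ d) :* f)) :=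
        ((a :* e :+ :- (b :* f)) :+ (c :* e :+ :- (d :* f))))
        ≡.refl (seq (re z) n) (seq (im z) n) (seq (re w) n) (seq (im w) n)
        (seq (re v) n) (seq (im v) n))
      (≗⇒≈ λ n → solve 6 (λ a b c d e f →
        ((a :+ c) :* f :+ (b :+ d) :* e) := ((a :* f :+ b :* e) :+ (c :* f :+ d :* e)))
        ≡.refl (seq (re z) n) (seq (im z) n) (seq (re w) n) (seq (im w) n)
        (seq (re v) n) (seq (im v) n))

  ℂ-commutativeRing : CommutativeRing 0ℓ 0ℓ
  ℂ-commutativeRing = record
    { Carrier = ℂ ; _≈_ = _≈_ ; _+_ = _+_ ; _*_ = _*_ ; -_ = -_ ; 0# = 0ℂ ; 1# = 1ℂ
    ; isCommutativeRing = record
      { isRing = record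
        { +-isAbelianGroup = record
          { isGroup = record
            { isMonoid = record
              { isSemigroup = record
                { isMagma = record
                  { isEquivalence = record { refl = ≈-refl ; sym = ≈-sym ; trans = ≈-trans }
                  ; ∙-cong = +-cong }
                ; assoc = λ z w v → mk≈ (R.+-assoc (re z) (re w) (re v))
                                        (R.+-assoc (im z) (im w) (im v)) }
              ; identity = (λ z → mk≈ (R.+-identityˡ (re z)) (R.+-identityˡ (im z)))
                         , (λ z → mk≈ (R.+-identityʳ (re z)) (R.+-identityʳ (im z))) }
            ; inverse = (λ z → mk≈ (R.-‿inverseˡ (re z)) (R.-‿inverseˡ (im z)))
                      , (λ z → mk≈ (R.-‿inverseʳ (re z)) (R.-‿inverseʳ (im z)))
            ; ⁻¹-cong = λ z≈w → mk≈ (R.-‿cong (re≈ z≈w)) (R.-‿cong (im≈ z≈w)) }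
          ; comm = λ z w → mk≈ (R.+-comm (re z) (re w)) (R.+-comm (im z) (im w)) }
        ; *-cong = *-cong
        ; *-assoc = *-assoc
        ; *-identity = *-identityˡ , λ z → ≈-trans (*-comm z 1ℂ) (*-identityˡ z)
        ; distrib = (λ v z w → ≈-trans (*-comm v (z + w)) (≈-trans (*-distribʳ-+ v z w)
                                 (+-cong (*-comm z v) (*-comm w v))))
                  , *-distribʳ-+ }
      ; *-comm = *-comm } }

  ∣_∣² : ℂ → ℝ
  ∣ z ∣² = re z *ᴿ re z +ᴿ im z *ᴿ im z

  -- z ≠ 0, in the positive form that provides a reciprocal.
  infix 4 _≠0
  _≠0 : ℂ → Set
  z ≠0 = R.0# Real.< ∣ z ∣²

  conj : ℂ → ℂ
  conj z .re = re z
  conj z .im = -ᴿ im z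

  recip : ∀ z → z ≠0 → ℂ
  recip z z≠0 = conj z * fromℝ (Real.recip ∣ z ∣² z≠0)

  recip-inverse : ∀ z (z≠0 : z ≠0) → z * recip z z≠0 ≈ 1ℂ
  recip-inverse z z≠0 = ≈-trans (≈-sym (*-assoc z (conj z) (fromℝ r)))
    (≈-trans (*-cong z*conj ≈-refl) ∣z∣²*r)
    where
    r : ℝ
    r = Real.recip ∣ z ∣² z≠0
    z*conj : z * conj z ≈ fromℝ ∣ z ∣²
    z*conj = mk≈
      (≗⇒≈ λ n → solve 2 (λ a b → a :* a :+ :- (b :* (:- b)) := a :* a :+ b :* b)
        ≡.refl (seq (re z) n) (seq (im z) n))
      (≗⇒≈ λ n → solve 2 (λ a b → a :* (:- b) :+ b :* a := con 0ℚ)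
        ≡.refl (seq (re z) n) (seq (im z) n))
    ∣z∣²*r : fromℝ ∣ z ∣² * fromℝ r ≈ 1ℂ
    ∣z∣²*r = mk≈
      (R.trans (≗⇒≈ λ n → solve 2 (λ a b → a :* b :+ :- (con 0ℚ :* con 0ℚ) := a :* b)
        ≡.refl (seq ∣ z ∣² n) (seq r n)) (Real.recip-inverse ∣ z ∣² z≠0))
      (≗⇒≈ λ n → solve 2 (λ a b → a :* con 0ℚ :+ con 0ℚ :* b := con 0ℚ)
        ≡.refl (seq ∣ z ∣² n) (seq r n))

open Complex public using (ℂ; ℂ-commutativeRing; ∣_∣²; _≠0; recip)
open CommutativeRing ℂ-commutativeRing public
  using (_≈_; _+_; _*_; -_; _-_; 0#; 1#) renaming (setoid to ℂ-setoid)
private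
  module C = CommutativeRing ℂ-commutativeRing

infixl 7 _/_[_]
_/_[_] : ℂ → (z : ℂ) → z ≠0 → ℂ
w / z [ z≠0 ] = w * recip z z≠0

-- |z - w| < ε; for ε > 0 this is |z - w|² < ε².
infix 4 ∣_-_∣<_
∣_-_∣<_ : ℂ → ℂ → ℝ → Set
∣ z - w ∣< ε = ∣ z - w ∣² Real.< ε Real.* ε

ι : ℕ → ℂ
ι n = RawMonoid._×_ C.+-rawMonoid n 1#

ι≠0 : ∀ k → ι (suc k) ≠0
ι≠0 k = Real.mk< (q (suc k) ℚ.* q (suc k)) (Rat.0<* (0<q k) (0<q k)) (0 , λ n _ →
  ℚ.≤-reflexive (≡.sym (≡.trans
    (≡.cong₂ ℚ._+_ (≡.cong₂ ℚ._*_ (re≡ (suc k) n) (re≡ (suc k) n))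
                   (≡.cong₂ ℚ._*_ (im≡ (suc k) n) (im≡ (suc k) n)))
    (solve 1 (λ r → r :+ con 0ℚ :* con 0ℚ := con 0ℚ :+ r) ≡.refl (q (suc k) ℚ.* q (suc k))))))
  where
  open +-*-Solver
  open Real using (seq)
  open Complex using (re; im)
  q : ℕ → ℚ
  q zero    = 0ℚ
  q (suc k) = 1ℚ ℚ.+ q k
  0<q : ∀ k → 0ℚ ℚ.< q (suc k)
  0<q zero    = ℚ.positive⁻¹ 1ℚ
  0<q (suc k) = Rat.0<+ (ℚ.positive⁻¹ 1ℚ) (0<q k)
  re≡ : ∀ k n → seq (re (ι k)) n ≡ q k
  re≡ zero    n = ≡.refl
  re≡ (suc k) n = ≡.cong (1ℚ ℚ.+_) (re≡ k n)
  im≡ : ∀ k n → seq (im (ι k)) n ≡ 0ℚ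
  im≡ zero    n = ≡.refl
  im≡ (suc k) n = ≡.cong (0ℚ ℚ.+_) (im≡ k n)

∑ : ∀ {n} → (Fin n → ℂ) → ℂ
∑ = RawMonoid.sum C.+-rawMonoid

infix 4 _⟶_
_⟶_ : (ℕ → ℂ) → ℂ → Set
a ⟶ L = ∀ ε → Real.0ℝ Real.< ε → ∃[ N ] ∀ n → N ℕ.≤ n → ∣ a n - L ∣< ε

Limit₀ : ((h : ℂ) → h ≠0 → ℂ) → ℂ → Set
Limit₀ φ L = ∀ ε → Real.0ℝ Real.< ε → ∃[ δ ] (Real.0ℝ Real.< δ) ×
  (∀ h (h≠0 : h ≠0) → ∣ h - 0# ∣< δ → ∣ φ h h≠0 - L ∣< ε)

HasDerivativeAt : (ℂ → ℂ) → ℂ → ℂ → Set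
HasDerivativeAt g z L = Limit₀ (λ h h≠0 → (g (z + h) - g z) / h [ h≠0 ]) L

Holomorphic : (ℂ → ℂ) → Set
Holomorphic g = ∀ z → ∃[ L ] HasDerivativeAt g z L

ℂ^ℂ-setoid : Setoid 0ℓ 0ℓ
ℂ^ℂ-setoid = ℂ-setoid ⇨ ℂ-setoid

ℂ^ℂ : Set
ℂ^ℂ = Func ℂ-setoid ℂ-setoid

shift : ℂ → ℂ^ℂ → ℂ^ℂ
shift c g = record { to = λ x → g ⟨$⟩ (x + c) ; cong = λ x≈y → Func.cong g (C.+-congʳ x≈y) }

combine : ℂ → ℂ^ℂ → ℂ → ℂ^ℂ → ℂ^ℂ
combine a f b g = record
  { to   = λ x → a * (f ⟨$⟩ x) + b * (g ⟨$⟩ x)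
  ; cong = λ x≈y → C.+-cong (C.*-congˡ (Func.cong f x≈y)) (C.*-congˡ (Func.cong g x≈y)) }

module _ (X : Pred ℂ^ℂ 0ℓ) where

  linearCombination : List (ℂ × ∃ X) → ℂ → ℂ
  linearCombination []                 x = 0#
  linearCombination ((c , g , _) ∷ ts) x = c * (g ⟨$⟩ x) + linearCombination ts x

  𝐋 : Pred ℂ^ℂ 0ℓ
  𝐋 h = ∃[ ts ] ∀ x → h ⟨$⟩ x ≈ linearCombination ts x

  𝐓 : Pred ℂ^ℂ 0ℓ
  𝐓 h = ∃[ g ] ∃[ c ] X g × (∀ x → h ⟨$⟩ x ≈ g ⟨$⟩ (x + c))

𝐒 : Pred ℂ^ℂ 0ℓ → Pred ℂ^ℂ 0ℓ
𝐒 X = 𝐋 (𝐓 X)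

module _ {X : Pred ℂ^ℂ 0ℓ} where

  private
    scale : ℂ → List (ℂ × ∃ X) → List (ℂ × ∃ X)
    scale a = map λ (c , g) → a * c , g

    scale-correct : ∀ a ts x →
      linearCombination X (scale a ts) x ≈ a * linearCombination X ts x
    scale-correct a []                 x = C.sym (C.zeroʳ a)
    scale-correct a ((c , g , _) ∷ ts) x = C.trans
      (C.+-cong (C.*-assoc a c (g ⟨$⟩ x)) (scale-correct a ts x))
      (C.sym (C.distribˡ a (c * (g ⟨$⟩ x)) (linearCombination X ts x)))

    ++-correct : ∀ ts us x → linearCombination X (ts ++ us) x ≈
      linearCombination X ts x + linearCombination X us x
    ++-correct []                 us x = C.sym (C.+-identityˡ _)
    ++-correct ((c , g , _) ∷ ts) us x = C.trans (C.+-congˡ (++-correct ts us x))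
      (C.sym (C.+-assoc (c * (g ⟨$⟩ x)) (linearCombination X ts x) (linearCombination X us x)))

  combine∈𝐋 : ∀ a b {f g} → f ∈ 𝐋 X → g ∈ 𝐋 X → combine a f b g ∈ 𝐋 X
  combine∈𝐋 a b (ts , f≈) (us , g≈) = scale a ts ++ scale b us , λ x → C.trans
    (C.+-cong (C.trans (C.*-congˡ (f≈ x)) (C.sym (scale-correct a ts x)))
              (C.trans (C.*-congˡ (g≈ x)) (C.sym (scale-correct b us x))))
    (C.sym (++-correct (scale a ts) (scale b us) x))

module _ {X : Pred ℂ^ℂ 0ℓ} where

  private
    shiftTerms : ℂ → List (ℂ × ∃ (𝐓 X)) → List (ℂ × ∃ (𝐓 X))
    shiftTerms s = map λ (c , h , g , d , g∈X , h≈) → c , shift s h , g , s + d , g∈X ,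
      λ x → C.trans (h≈ (x + s)) (Func.cong g (C.+-assoc x s d))

    shiftTerms-correct : ∀ s ts x → linearCombination (𝐓 X) (shiftTerms s ts) x ≈
      linearCombination (𝐓 X) ts (x + s)
    shiftTerms-correct s []       x = C.refl
    shiftTerms-correct s (_ ∷ ts) x = C.+-congˡ (shiftTerms-correct s ts x)

  shift∈𝐒 : ∀ s {f} → f ∈ 𝐒 X → shift s f ∈ 𝐒 X
  shift∈𝐒 s (ts , f≈) =
    shiftTerms s ts , λ x → C.trans (f≈ (x + s)) (C.sym (shiftTerms-correct s ts x))

-- Polynomials are lists of coefficients, in ascending order of degree.

Poly : Set
Poly = List ℂ

⟦_⟧ : Poly → ℂ → ℂ
⟦ [] ⟧    z = 0#
⟦ a ∷ p ⟧ z = a + z * ⟦ p ⟧ z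

coeff : Poly → ℕ → ℂ
coeff []      k       = 0#
coeff (a ∷ p) zero    = a
coeff (a ∷ p) (suc k) = coeff p k

DegreeAtMost : ℕ → Poly → Set
DegreeAtMost m p = ∀ k → m ℕ.< k → coeff p k ≈ 0#

-- ⊥₋ is the degree -∞ of the null polynomial.
HasDegree : ℕ ₋ → Poly → Set
HasDegree ⊥₋    p = ∀ k → coeff p k ≈ 0#
HasDegree [ d ] p = coeff p d ≠0 × DegreeAtMost d p

module Antidifference where

  open NatSolver C.commutativeSemiring using (solve; _:=_; _:+_; _:*_; con)
  open SetoidReasoning ℂ-setoid

  infixl 6 _⊕_
  _⊕_ : Poly → Poly → Poly
  []      ⊕ q       = q
  (a ∷ p) ⊕ []      = a ∷ p
  (a ∷ p) ⊕ (b ∷ q) = a + b ∷ p ⊕ q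

  ⊕-correct : ∀ p q z → ⟦ p ⊕ q ⟧ z ≈ ⟦ p ⟧ z + ⟦ q ⟧ z
  ⊕-correct []      q       z = C.sym (C.+-identityˡ _)
  ⊕-correct (a ∷ p) []      z = C.sym (C.+-identityʳ _)
  ⊕-correct (a ∷ p) (b ∷ q) z = C.trans
    (C.+-congˡ (C.*-congˡ (⊕-correct p q z)))
    (solve 5 (λ a b z p q → (a :+ b) :+ z :* (p :+ q) := (a :+ z :* p) :+ (b :+ z :* q))
      C.refl a b z (⟦ p ⟧ z) (⟦ q ⟧ z))

  -- multiplication by z + c
  times : ℂ → Poly → Poly
  times c p = map (c *_) p ⊕ (0# ∷ p)

  times-correct : ∀ c p z → ⟦ times c p ⟧ z ≈ (z + c) * ⟦ p ⟧ z
  times-correct c p z = begin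
    ⟦ times c p ⟧ z                          ≈⟨ ⊕-correct (map (c *_) p) (0# ∷ p) z ⟩
    ⟦ map (c *_) p ⟧ z + (0# + z * ⟦ p ⟧ z)  ≈⟨ C.+-cong (scale-correct p) (C.+-identityˡ _) ⟩
    c * ⟦ p ⟧ z + z * ⟦ p ⟧ z                ≈⟨ solve 3 (λ c z p → c :* p :+ z :* p := (z :+ c) :* p)
                                                  C.refl c z (⟦ p ⟧ z) ⟩
    (z + c) * ⟦ p ⟧ z                        ∎
    where
    scale-correct : ∀ p → ⟦ map (c *_) p ⟧ z ≈ c * ⟦ p ⟧ z
    scale-correct []      = C.sym (C.zeroʳ c)
    scale-correct (a ∷ p) = C.trans (C.+-congˡ (C.*-congˡ (scale-correct p)))
      (solve 4 (λ c a z p → c :* a :+ z :* (c :* p) := c :* (a :+ z :* p))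
        C.refl c a z (⟦ p ⟧ z))

  translate : ℂ → Poly → Poly
  translate c []      = []
  translate c (a ∷ p) = (a ∷ []) ⊕ times c (translate c p)

  translate-correct : ∀ c p z → ⟦ translate c p ⟧ z ≈ ⟦ p ⟧ (z + c)
  translate-correct c []      z = C.refl
  translate-correct c (a ∷ p) z = begin
    ⟦ (a ∷ []) ⊕ times c (translate c p) ⟧ z          ≈⟨ ⊕-correct (a ∷ []) (times c (translate c p)) z ⟩
    (a + z * 0#) + ⟦ times c (translate c p) ⟧ z      ≈⟨ C.+-cong (a+z0≈a a z) (times-correct c (translate c p) z) ⟩
    a + (z + c) * ⟦ translate c p ⟧ z                 ≈⟨ C.+-congˡ (C.*-congˡ (translate-correct c p z)) ⟩
    a + (z + c) * ⟦ p ⟧ (z + c)                       ∎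
    where
    a+z0≈a : ∀ a z → a + z * 0# ≈ a
    a+z0≈a a z = C.trans (C.+-congˡ (C.zeroʳ z)) (C.+-identityʳ a)

  -- The rising factorials z (z + 1) ⋯ (z + k - 1) have backward difference
  -- k z (z + 1) ⋯ (z + k - 2), so antidifferences are read off from the
  -- expansion of a polynomial in rising factorials.  For a list cs of
  -- coefficients, rising k cs z is the sum of the terms
  -- cⱼ (z + k) (z + k + 1) ⋯ (z + k + j - 1).
  rising : ℕ → List ℂ → ℂ → ℂ
  rising k []       z = 0#
  rising k (c ∷ cs) z = c + (z + ι k) * rising (suc k) cs z

  timesRising : ℕ → List ℂ → List ℂ
  timesRising k []       = []
  timesRising k (c ∷ cs) = (- ι k) * c ∷ (c ∷ []) ⊕ timesRising (suc k) cs

  rising-⊕ : ∀ k p q z → rising k (p ⊕ q) z ≈ rising k p z + rising k q z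
  rising-⊕ k []      q       z = C.sym (C.+-identityˡ _)
  rising-⊕ k (a ∷ p) []      z = C.sym (C.+-identityʳ _)
  rising-⊕ k (a ∷ p) (b ∷ q) z = C.trans
    (C.+-congˡ (C.*-congˡ (rising-⊕ (suc k) p q z)))
    (solve 5 (λ a b z p q → (a :+ b) :+ z :* (p :+ q) := (a :+ z :* p) :+ (b :+ z :* q))
      C.refl a b (z + ι k) (rising (suc k) p z) (rising (suc k) q z))

  rising-constant : ∀ k a z → rising k (a ∷ []) z ≈ a
  rising-constant k a z = C.trans (C.+-congˡ (C.zeroʳ _)) (C.+-identityʳ a)

  timesRising-correct : ∀ k cs z → rising k (timesRising k cs) z ≈ z * rising k cs z
  timesRising-correct k []       z = C.sym (C.zeroʳ z)
  timesRising-correct k (c ∷ cs) z = begin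
    (- ι k) * c + (z + ι k) * rising (suc k) ((c ∷ []) ⊕ timesRising (suc k) cs) z
      ≈⟨ C.+-congˡ (C.*-congˡ (C.trans (rising-⊕ (suc k) (c ∷ []) (timesRising (suc k) cs) z)
           (C.+-cong (rising-constant (suc k) c z) (timesRising-correct (suc k) cs z)))) ⟩
    (- ι k) * c + (z + ι k) * (c + z * r)
      ≈⟨ solve 5 (λ m c z k r → m :* c :+ (z :+ k) :* (c :+ z :* r) :=
           (m :+ k) :* c :+ z :* (c :+ (z :+ k) :* r)) C.refl (- ι k) c z (ι k) r ⟩
    (- ι k + ι k) * c + z * (c + (z + ι k) * r)
      ≈⟨ C.+-congʳ (C.trans (C.*-congʳ (C.-‿inverseˡ (ι k))) (C.zeroˡ c)) ⟩
    0# + z * (c + (z + ι k) * r)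
      ≈⟨ C.+-identityˡ _ ⟩
    z * (c + (z + ι k) * r) ∎
    where
    r : ℂ
    r = rising (suc k) cs z

  toRising : Poly → List ℂ
  toRising []      = []
  toRising (a ∷ p) = (a ∷ []) ⊕ timesRising 0 (toRising p)

  toRising-correct : ∀ p z → rising 0 (toRising p) z ≈ ⟦ p ⟧ z
  toRising-correct []      z = C.refl
  toRising-correct (a ∷ p) z = C.trans
    (rising-⊕ 0 (a ∷ []) (timesRising 0 (toRising p)) z)
    (C.+-cong (rising-constant 0 a z)
      (C.trans (timesRising-correct 0 (toRising p) z) (C.*-congˡ (toRising-correct p z))))

  fromRising : ℕ → List ℂ → Poly
  fromRising k []       = []
  fromRising k (c ∷ cs) = (c ∷ []) ⊕ times (ι k) (fromRising (suc k) cs)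

  fromRising-correct : ∀ k cs z → ⟦ fromRising k cs ⟧ z ≈ rising k cs z
  fromRising-correct k []       z = C.refl
  fromRising-correct k (c ∷ cs) z = C.trans
    (⊕-correct (c ∷ []) (times (ι k) (fromRising (suc k) cs)) z)
    (C.+-cong (C.trans (C.+-congˡ (C.zeroʳ z)) (C.+-identityʳ c))
      (C.trans (times-correct (ι k) (fromRising (suc k) cs) z)
        (C.*-congˡ (fromRising-correct (suc k) cs z))))

  divide : ℕ → List ℂ → List ℂ
  divide k []       = []
  divide k (c ∷ cs) = c / ι (suc k) [ ι≠0 k ] ∷ divide (suc k) cs

  rising-cong : ∀ k cs {z w} → z ≈ w → rising k cs z ≈ rising k cs w
  rising-cong k []       z≈w = C.refl
  rising-cong k (c ∷ cs) z≈w =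
    C.+-congˡ (C.*-cong (C.+-congʳ z≈w) (rising-cong (suc k) cs z≈w))

  divide-correct : ∀ k cs w →
    (w + 1# + ι k) * rising (suc k) (divide k cs) (w + 1#) ≈
    w * rising (suc k) (divide k cs) w + rising k cs (w + 1#)
  divide-correct k []       w = C.trans (C.zeroʳ _)
    (C.sym (C.trans (C.+-identityʳ _) (C.zeroʳ w)))
  divide-correct k (c ∷ cs) w = begin
    (w + 1# + ι k) * (d + (w + 1# + ι (suc k)) * r₁)
      ≈⟨ solve 4 (λ v k d x → (v :+ k) :* (d :+ x) := (v :+ k) :* d :+ (v :+ k) :* x)
           C.refl (w + 1#) (ι k) d ((w + 1# + ι (suc k)) * r₁) ⟩
    (w + 1# + ι k) * d + (w + 1# + ι k) * ((w + 1# + ι (suc k)) * r₁)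
      ≈⟨ C.+-congˡ (C.*-congˡ (divide-correct (suc k) cs w)) ⟩
    (w + 1# + ι k) * d + (w + 1# + ι k) * (w * r₀ + s)
      ≈⟨ solve 6 (λ w k d r s o →
           (w :+ o :+ k) :* d :+ (w :+ o :+ k) :* (w :* r :+ s) :=
           w :* (d :+ (w :+ (o :+ k)) :* r) :+ ((o :+ k) :* d :+ (w :+ o :+ k) :* s))
           C.refl w (ι k) d r₀ s 1# ⟩
    w * (d + (w + ι (suc k)) * r₀) + (ι (suc k) * d + (w + 1# + ι k) * s)
      ≈⟨ C.+-congˡ (C.+-congʳ cancel) ⟩
    w * (d + (w + ι (suc k)) * r₀) + (c + (w + 1# + ι k) * s) ∎
    where
    d r₀ r₁ s i : ℂ
    d  = c / ι (suc k) [ ι≠0 k ]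
    r₀ = rising (suc (suc k)) (divide (suc k) cs) w
    r₁ = rising (suc (suc k)) (divide (suc k) cs) (w + 1#)
    s  = rising (suc k) cs (w + 1#)
    i  = recip (ι (suc k)) (ι≠0 k)
    cancel : ι (suc k) * d ≈ c
    cancel = begin
      ι (suc k) * (c * i)  ≈⟨ solve 3 (λ a c i → a :* (c :* i) := c :* (a :* i)) C.refl (ι (suc k)) c i ⟩
      c * (ι (suc k) * i)  ≈⟨ C.*-congˡ (Complex.recip-inverse (ι (suc k)) (ι≠0 k)) ⟩
      c * 1#               ≈⟨ C.*-identityʳ c ⟩
      c                    ∎

  -- P is determined by p, since a polynomial that vanishes on ℕ is null.
  antidifference : ∀ p → ∃[ P ] (∀ z → ⟦ P ⟧ z - ⟦ P ⟧ (z - 1#) ≈ ⟦ p ⟧ z) × ⟦ P ⟧ 0# ≈ 0#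
  antidifference p = 0# ∷ fromRising 1 cs , difference , at0
    where
    cs : List ℂ
    cs = divide 0 (toRising p)
    P : ℂ → ℂ
    P z = z * rising 1 cs z
    P-correct : ∀ z → ⟦ 0# ∷ fromRising 1 cs ⟧ z ≈ P z
    P-correct z = C.trans (C.+-identityˡ _) (C.*-congˡ (fromRising-correct 1 cs z))
    at0 : ⟦ 0# ∷ fromRising 1 cs ⟧ 0# ≈ 0#
    at0 = C.trans (P-correct 0#) (C.zeroˡ _)
    difference : ∀ z → ⟦ 0# ∷ fromRising 1 cs ⟧ z - ⟦ 0# ∷ fromRising 1 cs ⟧ (z - 1#) ≈ ⟦ p ⟧ z
    difference z = begin
      ⟦ 0# ∷ fromRising 1 cs ⟧ z - ⟦ 0# ∷ fromRising 1 cs ⟧ w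
        ≈⟨ C.+-cong (P-correct z) (C.-‿cong (P-correct w)) ⟩
      z * rising 1 cs z - P w
        ≈⟨ C.+-congʳ (C.*-cong z≈ (rising-cong 1 cs (C.sym w+1≈z))) ⟩
      (w + 1# + 0#) * rising 1 cs (w + 1#) - P w
        ≈⟨ C.+-congʳ (divide-correct 0 (toRising p) w) ⟩
      P w + rising 0 (toRising p) (w + 1#) - P w
        ≈⟨ solve 3 (λ a b c → a :+ b :+ c := b :+ (a :+ c)) C.refl
             (P w) (rising 0 (toRising p) (w + 1#)) (- P w) ⟩
      rising 0 (toRising p) (w + 1#) + (P w - P w)
        ≈⟨ C.+-cong (C.trans (rising-cong 0 (toRising p) w+1≈z) (toRising-correct p z))
                    (C.-‿inverseʳ (P w)) ⟩
      ⟦ p ⟧ z + 0#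
        ≈⟨ C.+-identityʳ _ ⟩
      ⟦ p ⟧ z ∎
      where
      w : ℂ
      w = z - 1#
      w+1≈z : w + 1# ≈ z
      w+1≈z = C.trans (C.+-assoc z (- 1#) 1#)
        (C.trans (C.+-congˡ (C.-‿inverseˡ 1#)) (C.+-identityʳ z))
      z≈ : z ≈ w + 1# + 0#
      z≈ = C.sym (C.trans (C.+-identityʳ _) w+1≈z)

open Antidifference public using (translate; antidifference)

-- The fractional sum of p from x to y.
∑ᵖ : Poly → ℂ → ℂ → ℂ
∑ᵖ p x y = ⟦ P ⟧ y - ⟦ P ⟧ (x - 1#)
  where
  P : Poly
  P = proj₁ (antidifference p)

FractionalSummable : Pred ℂ^ℂ 0ℓ
FractionalSummable f = ∃[ m ] ∃ λ (p : ℕ → Poly) →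
  (∀ n → DegreeAtMost m (p n)) ×
  (∀ x → (λ n → (f ⟨$⟩ (ι n + x)) - ⟦ p n ⟧ (ι n + x)) ⟶ 0#) ×
  (∀ x y → ∃[ L ] (λ n → ∑ᵖ (p n) (ι n + x) (ι n + y) +
    ∑ {n} (λ ν → (f ⟨$⟩ (ι (suc (toℕ ν)) + x - 1#)) - (f ⟨$⟩ (ι (suc (toℕ ν)) + y)))) ⟶ L)

Entire : Pred ℂ^ℂ 0ℓ
Entire f = Holomorphic (f ⟨$⟩_)

ℱ : Pred ℂ^ℂ 0ℓ
ℱ = 𝐋 (Entire ∪ FractionalSummable)

module _ (𝒰 : Pred ℂ^ℂ 0ℓ) where

  -- Maps on 𝐒 𝒰 are insensitive to the presentation of a function as a linear
  -- combination of translates.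
  𝐒-setoid : Setoid 0ℓ 0ℓ
  𝐒-setoid = On.setoid {B = ∃ (𝐒 𝒰)} ℂ^ℂ-setoid proj₁

  SumMap : Set
  SumMap = Func (𝐒-setoid ×ₛ (ℂ-setoid ×ₛ ℂ-setoid)) ℂ-setoid

module _ {𝒰 : Pred ℂ^ℂ 0ℓ} where

  infix 9 _⟪_∶_⋯_⟫
  _⟪_∶_⋯_⟫ : SumMap 𝒰 → ∃ (𝐒 𝒰) → ℂ → ℂ → ℂ
  F ⟪ f ∶ x ⋯ y ⟫ = F ⟨$⟩ (f , x , y)

  shiftˢ : ℂ → ∃ (𝐒 𝒰) → ∃ (𝐒 𝒰)
  shiftˢ s (f , f∈) = shift s f , shift∈𝐒 {X = 𝒰} s {f} f∈

  combineˢ : ℂ → ∃ (𝐒 𝒰) → ℂ → ∃ (𝐒 𝒰) → ∃ (𝐒 𝒰)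
  combineˢ a (f , f∈) b (g , g∈) = combine a f b g , combine∈𝐋 {X = 𝐓 𝒰} a b {f} {g} f∈ g∈

  record IsFractionalSum (F : SumMap 𝒰) : Set where
    field
      continued    : ∀ f x y z →
                     F ⟪ f ∶ x ⋯ y ⟫ + F ⟪ f ∶ y + 1# ⋯ z ⟫ ≈ F ⟪ f ∶ x ⋯ z ⟫
      shifted      : ∀ f x y s → F ⟪ f ∶ x + s ⋯ y + s ⟫ ≈ F ⟪ shiftˢ s f ∶ x ⋯ y ⟫
      linear       : ∀ a f b g x y → F ⟪ combineˢ a f b g ∶ x ⋯ y ⟫ ≈
                     a * F ⟪ f ∶ x ⋯ y ⟫ + b * F ⟪ g ∶ x ⋯ y ⟫
      singleton    : ∀ f → F ⟪ f ∶ 1# ⋯ 1# ⟫ ≈ proj₁ f ⟨$⟩ 1#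
      holomorphic  : ∀ f → Entire (proj₁ f) → Holomorphic (λ x → F ⟪ f ∶ 1# ⋯ x ⟫)
      vanishing    : ∀ f → (∀ t → (λ n → proj₁ f ⟨$⟩ (t + ι n)) ⟶ 0#) →
                     ∀ x y → (λ n → F ⟪ shiftˢ (ι n) f ∶ x ⋯ y ⟫) ⟶ 0#
      -- The degree d may be -∞; replacing "of degree d" by "of degree at most d"
      -- would change nothing, since a suitable perturbation of the coefficient
      -- of degree d that tends to 0 rapidly makes every degree equal to d.
      asymptotic   : ∀ f d (p : ℕ → Poly) → (∀ n → HasDegree d (p n)) →
                     (∀ t → (λ n → (proj₁ f ⟨$⟩ (t + ι n)) - ⟦ p n ⟧ (t + ι n)) ⟶ 0#) →
                     ∀ x y → (λ n → F ⟪ shiftˢ (ι n) f ∶ x ⋯ y ⟫ -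
                                    ∑ᵖ (translate (ι n) (p n)) x y) ⟶ 0#

record Summable (𝒰 : Pred ℂ^ℂ 0ℓ) : Set where
  field
    𝒰⊆ℱ             : 𝒰 ⊆ ℱ
    fractionalSum   : SumMap 𝒰
    isFractionalSum : IsFractionalSum fractionalSum
    unique          : ∀ (F : SumMap 𝒰) → IsFractionalSum F →
                      ∀ f x y → F ⟪ f ∶ x ⋯ y ⟫ ≈ fractionalSum ⟪ f ∶ x ⋯ y ⟫
open Summable public using (fractionalSum)

IsEssence : ∀ {𝒰} → Summable 𝒰 → ∃ (𝐒 𝒰) → ℂ → Set
IsEssence U f = Limit₀ λ h h≠0 → 1# / h [ h≠0 ] * fractionalSum U ⟪ f ∶ 1# ⋯ h ⟫

{-# OPTIONS --safe #-}

-- Write T x = ∑_1^x f and X x = ∑_1^x f′.  Summing (ii) from 1 to x gives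
--   T (x + h) − T x − T h = u(h) X x + ∑ₘ vₘ(h) ∑_1^x wₘ,
-- and T is holomorphic with T 0 = 0, so E = ess f is T′(0) and
-- (u(h)/h) X x → T′(x) − E.  By (ii) itself, (u(h)/h) f′(y) → f′(y) for all y.
-- Hence Z = T′(x) − E − X x satisfies Z f′(y) = 0 for all y.  Whether f′ vanishes
-- is not decidable, but Z ≠ 0 would force f′ = 0, then X x = 0 and
-- T′(x) − E = 0, that is Z = 0; and equality on ℂ is the negation of apartness.
module Submission where

open import Defs
open import Algebra.Bundles using (CommutativeRing)
import Algebra.Properties.Semiring.Sum as SemiringSum
import Algebra.Solver.Ring as RingSolver
import Algebra.Solver.Ring.AlmostCommutativeRing as ACR
open import Data.Empty using (⊥-elim)
open import Data.Fin.Base using (Fin; zero; suc)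
open import Data.List.Base using ([])
open import Data.Maybe.Base using (just; nothing)
open import Data.Nat.Base as ℕ using (ℕ; zero; suc)
import Data.Nat.Properties as ℕ
open import Data.Product.Base using (∃; ∃-syntax; _×_; _,_; proj₁; proj₂)
open import Data.Rational.Base as ℚ using (ℚ; 0ℚ; 1ℚ; ½)
import Data.Rational.Properties as ℚ
open import Data.Rational.Solver using (module +-*-Solver)
open import Data.Sum.Base using (_⊎_; inj₁; inj₂)
open import Function.Bundles using (Func; _⟨$⟩_)
open import Level using (0ℓ)
open import Relation.Binary.Definitions using (WeaklyDecidable)
open import Relation.Binary.PropositionalEquality as ≡ using (_≡_)
import Relation.Binary.Reasoning.Setoid as SetoidReasoning
open import Relation.Nullary using (¬_; yes; no)
open import Relation.Unary using (Pred; _∈_)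
open Rat using (Eventually; both; 0<+; 0<*; ½ε; halves)
open Real using (ℝ; seq; cauchy; close; fromℚ; 0ℝ; mk<; ≗⇒≈; gap; 0<gap; separated; bounded)
  renaming (_<_ to _<ᴿ_; _≈_ to _≈ᴿ_; _+_ to _+ᴿ_; _*_ to _*ᴿ_)
open Complex using (re; im; fromℝ)
private
  module C = CommutativeRing ℂ-commutativeRing
  module R = CommutativeRing Real.ℝ-commutativeRing

-- Rational inequalities

module _ where

  open +-*-Solver

  abstract

    0≤p*p : ∀ p → 0ℚ ℚ.≤ p ℚ.* p
    0≤p*p p with ℚ.≤-total 0ℚ p
    ... | inj₁ 0≤p = ≡.subst (ℚ._≤ p ℚ.* p) (ℚ.*-zeroˡ p)
      (ℚ.*-monoʳ-≤-nonNeg p {{ℚ.nonNegative 0≤p}} 0≤p)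
    ... | inj₂ p≤0 = ≡.subst (ℚ._≤ p ℚ.* p) (ℚ.*-zeroˡ p)
      (ℚ.*-monoʳ-≤-nonPos p {{ℚ.nonPositive p≤0}} p≤0)

    0≤p²+q² : ∀ p q → 0ℚ ℚ.≤ p ℚ.* p ℚ.+ q ℚ.* q
    0≤p²+q² p q = ℚ.+-mono-≤ (0≤p*p p) (0≤p*p q)

    p≤p+q : ∀ {p q} → 0ℚ ℚ.≤ q → p ℚ.≤ p ℚ.+ q
    p≤p+q {p} {q} 0≤q = ≡.subst (ℚ._≤ p ℚ.+ q) (ℚ.+-identityʳ p) (ℚ.+-monoʳ-≤ p 0≤q)

    p≤∣p∣ : ∀ p → p ℚ.≤ ℚ.∣ p ∣
    p≤∣p∣ p with ℚ.≤-total 0ℚ p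
    ... | inj₁ 0≤p = ℚ.≤-reflexive (≡.sym (ℚ.0≤p⇒∣p∣≡p 0≤p))
    ... | inj₂ p≤0 = ℚ.≤-trans p≤0 (ℚ.0≤∣p∣ p)

    ∣p-q∣<ε⇒p≤q+ε : ∀ p q {ε} → ℚ.∣ p ℚ.- q ∣ ℚ.< ε → p ℚ.≤ q ℚ.+ ε
    ∣p-q∣<ε⇒p≤q+ε p q {ε} pq = ≡.subst (ℚ._≤ q ℚ.+ ε)
      (solve 2 (λ p q → q :+ (p :+ :- q) := p) ≡.refl p q)
      (ℚ.+-monoʳ-≤ q (ℚ.≤-trans (p≤∣p∣ (p ℚ.- q)) (ℚ.<⇒≤ pq)))

    -- By contraposition: `q ≤ ∣p∣` with `q` positive squares to `q² ≤ p²`. This is how bounds on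
    -- squared moduli come back to bounds on coordinates.
    p²<q²⇒∣p∣<q : ∀ {p q} → 0ℚ ℚ.< q → p ℚ.* p ℚ.< q ℚ.* q → ℚ.∣ p ∣ ℚ.< q
    p²<q²⇒∣p∣<q {p} {q} 0<q p²<q² with ℚ.∣ p ∣ ℚ.<? q
    ... | yes p<q = p<q
    ... | no  p≮q = ⊥-elim (ℚ.<-irrefl ≡.refl (ℚ.<-≤-trans p²<q² (ℚ.≤-trans
      (ℚ.≤-trans (ℚ.*-monoˡ-≤-nonNeg q {{ℚ.nonNegative (ℚ.<⇒≤ 0<q)}} q≤p)
                 (ℚ.*-monoʳ-≤-nonNeg ℚ.∣ p ∣ {{ℚ.nonNegative (ℚ.0≤∣p∣ p)}} q≤p))
      (ℚ.≤-reflexive (≡.trans (≡.sym (ℚ.∣p*q∣≡∣p∣*∣q∣ p p)) (ℚ.0≤p⇒∣p∣≡p (0≤p*p p)))))))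
      where
      q≤p : q ℚ.≤ ℚ.∣ p ∣
      q≤p = ℚ.≮⇒≥ p≮q

    0<⊓ : ∀ {p q} → 0ℚ ℚ.< p → 0ℚ ℚ.< q → 0ℚ ℚ.< p ℚ.⊓ q
    0<⊓ {p} {q} 0<p 0<q with ℚ.⊓-sel p q
    ... | inj₁ ≡p = ≡.subst (0ℚ ℚ.<_) (≡.sym ≡p) 0<p
    ... | inj₂ ≡q = ≡.subst (0ℚ ℚ.<_) (≡.sym ≡q) 0<q

    -- A substitute for square roots. With `t` the minimum of `q/2` and `1`, `t² ≤ t ≤ q/2 < q`.
    square-below : ∀ q → 0ℚ ℚ.< q → ∃[ t ] 0ℚ ℚ.< t × t ℚ.* t ℚ.< q
    square-below q 0<q = t , 0<t , ℚ.≤-<-trans t²≤t t<q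
      where
      t : ℚ
      t = (q ℚ.* ½) ℚ.⊓ 1ℚ
      0<t : 0ℚ ℚ.< t
      0<t = 0<⊓ (½ε 0<q) (ℚ.positive⁻¹ 1ℚ)
      t²≤t : t ℚ.* t ℚ.≤ t
      t²≤t = ≡.subst (t ℚ.* t ℚ.≤_) (ℚ.*-identityʳ t)
        (ℚ.*-monoˡ-≤-nonNeg t {{ℚ.nonNegative (ℚ.<⇒≤ 0<t)}} (ℚ.p⊓q≤q (q ℚ.* ½) 1ℚ))
      t<q : t ℚ.< q
      t<q = ℚ.≤-<-trans (ℚ.p⊓q≤p (q ℚ.* ½) 1ℚ)
        (≡.subst₂ ℚ._<_ (ℚ.+-identityʳ (q ℚ.* ½)) (halves q) (ℚ.+-monoʳ-< (q ℚ.* ½) (½ε 0<q)))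

-- Order on ℝ

infix 4 _≲_
-- This compares the representing sequences, so it does not respect `≈`; it is stronger than `≤` on
-- reals. It suffices because it is only established termwise for explicit sequences.
_≲_ : ℝ → ℝ → Set
x ≲ y = Eventually (λ n → seq x n ℚ.≤ seq y n)

abstract

  <-≲-trans : ∀ {x y z} → x <ᴿ y → y ≲ z → x <ᴿ z
  <-≲-trans x<y y≲z = mk< (gap x<y) (0<gap x<y) (both (λ _ → ℚ.≤-trans) (separated x<y) y≲z)

  ≲-<-trans : ∀ {x y z} → x ≲ y → y <ᴿ z → x <ᴿ z
  ≲-<-trans x≲y y<z = mk< (gap y<z) (0<gap y<z)
    (both (λ _ x≤y → ℚ.≤-trans (ℚ.+-monoˡ-≤ (gap y<z) x≤y)) x≲y (separated y<z))

  -- Equal reals have sequences that are eventually within half the gap of each other, and the other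
  -- half of the gap remains.
  <-respˡ-≈ : ∀ {x y z} → x ≈ᴿ y → x <ᴿ z → y <ᴿ z
  <-respˡ-≈ {x} {y} x≈y x<z = mk< (g ℚ.* ½) (½ε (0<gap x<z))
    (both (λ n yx x≤z → ℚ.≤-trans
        (ℚ.+-monoˡ-≤ (g ℚ.* ½) (∣p-q∣<ε⇒p≤q+ε (seq y n) (seq x n) yx))
        (ℚ.≤-trans (ℚ.≤-reflexive (≡.trans (ℚ.+-assoc (seq x n) (g ℚ.* ½) (g ℚ.* ½))
          (≡.cong (seq x n ℚ.+_) (halves g)))) x≤z))
      (close (Real.≈-sym x≈y) (g ℚ.* ½) (½ε (0<gap x<z))) (separated x<z))
    where
    g : ℚ
    g = gap x<z

  +-mono-<ᴿ : ∀ {x y u v} → x <ᴿ y → u <ᴿ v → x +ᴿ u <ᴿ y +ᴿ v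
  +-mono-<ᴿ {x} {y} {u} {v} x<y u<v = mk< (g ℚ.+ h) (0<+ (0<gap x<y) (0<gap u<v))
    (both (λ n p q → ℚ.≤-trans (ℚ.≤-reflexive
        (solve 4 (λ x u g h → (x :+ u) :+ (g :+ h) := (x :+ g) :+ (u :+ h))
          ≡.refl (seq x n) (seq u n) g h))
        (ℚ.+-mono-≤ p q))
      (separated x<y) (separated u<v))
    where
    open +-*-Solver
    g h : ℚ
    g = gap x<y
    h = gap u<v

  fromℚ-mono-< : ∀ {p q} → p ℚ.< q → fromℚ p <ᴿ fromℚ q
  fromℚ-mono-< {p} {q} p<q = mk< (q ℚ.- p)
    (≡.subst (ℚ._< q ℚ.- p) (ℚ.+-inverseʳ p) (ℚ.+-monoˡ-< (ℚ.- p) p<q))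
    (0 , λ _ _ → ℚ.≤-reflexive (solve 2 (λ p q → p :+ (q :+ :- p) := q) ≡.refl p q))
    where open +-*-Solver

  fromℚ-cancel-< : ∀ {p q} → fromℚ p <ᴿ fromℚ q → p ℚ.< q
  fromℚ-cancel-< {p} p<q with separated p<q
  ... | N , s = ℚ.<-≤-trans (≡.subst (ℚ._< p ℚ.+ gap p<q) (ℚ.+-identityʳ p)
    (ℚ.+-monoʳ-< p (0<gap p<q))) (s N ℕ.≤-refl)

  0<⇒fromℚ≲ : ∀ {x} (0<x : 0ℝ <ᴿ x) → fromℚ (gap 0<x) ≲ x
  0<⇒fromℚ≲ {x} 0<x with separated 0<x
  ... | N , s = N , λ n n≥ → ≡.subst (ℚ._≤ seq x n) (ℚ.+-identityˡ (gap 0<x)) (s n n≥)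

  0<⇒gap²≲ : ∀ {x} (0<x : 0ℝ <ᴿ x) → fromℚ (gap 0<x ℚ.* gap 0<x) ≲ x *ᴿ x
  0<⇒gap²≲ {x} 0<x with 0<⇒fromℚ≲ 0<x
  ... | N , s = N , λ n n≥ → ℚ.≤-trans
    (ℚ.*-monoˡ-≤-nonNeg g {{ℚ.nonNegative 0≤g}} (s n n≥))
    (ℚ.*-monoʳ-≤-nonNeg (seq x n) {{ℚ.nonNegative (ℚ.≤-trans 0≤g (s n n≥))}} (s n n≥))
    where
    g : ℚ
    g = gap 0<x
    0≤g : 0ℚ ℚ.≤ g
    0≤g = ℚ.<⇒≤ (0<gap 0<x)

  -- The decidable replacement for comparing `x` with `0`. From index `N` on, the sequence stays
  -- within `q/4` of `seq x N`; comparing that single rational with `q/2` leaves a gap of `q/4` on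
  -- either side.
  <-cotrans : ∀ x {q} → 0ℚ ℚ.< q → 0ℝ <ᴿ x ⊎ x <ᴿ fromℚ q
  <-cotrans x {q} 0<q with cauchy x (q ℚ.* ½ ℚ.* ½) (½ε (½ε 0<q))
  ... | N , c with seq x N ℚ.≤? q ℚ.* ½
  ...   | yes x≤ = inj₂ (mk< e (½ε (½ε 0<q)) (N , λ n n≥ → ℚ.≤-trans
          (ℚ.+-monoˡ-≤ e (ℚ.≤-trans (∣p-q∣<ε⇒p≤q+ε (seq x n) (seq x N) (c n N n≥ ℕ.≤-refl))
            (ℚ.+-monoˡ-≤ e x≤)))
          (ℚ.≤-reflexive (≡.trans (ℚ.+-assoc (q ℚ.* ½) e e)
            (≡.trans (≡.cong (q ℚ.* ½ ℚ.+_) (halves (q ℚ.* ½))) (halves q))))))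
    where
    e : ℚ
    e = q ℚ.* ½ ℚ.* ½
  ...   | no x≰ = inj₁ (mk< e (½ε (½ε 0<q)) (N , λ n n≥ → ≡.subst₂ ℚ._≤_
          (solve 1 (λ e → (e :+ e) :+ :- e := con 0ℚ :+ e) ≡.refl e)
          (solve 2 (λ x e → (x :+ e) :+ :- e := x) ≡.refl (seq x n) e)
          (ℚ.+-monoˡ-≤ (ℚ.- e) (ℚ.≤-trans (ℚ.≤-reflexive (halves (q ℚ.* ½)))
            (ℚ.≤-trans (ℚ.<⇒≤ (ℚ.≰⇒> x≰))
              (∣p-q∣<ε⇒p≤q+ε (seq x N) (seq x n) (c N n ℕ.≤-refl n≥)))))))
    where
    open +-*-Solver
    e : ℚ
    e = q ℚ.* ½ ℚ.* ½

-- The modulus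

abstract

  ∣∣²-cong : ∀ {z w} → z ≈ w → ∣ z ∣² ≈ᴿ ∣ w ∣²
  ∣∣²-cong z≈w = R.+-cong (R.*-cong (Complex.re≈ z≈w) (Complex.re≈ z≈w))
                          (R.*-cong (Complex.im≈ z≈w) (Complex.im≈ z≈w))

  ∣z∣²<q-resp-≈ : ∀ {z w q} → z ≈ w → ∣ z ∣² <ᴿ q → ∣ w ∣² <ᴿ q
  ∣z∣²<q-resp-≈ z≈w = <-respˡ-≈ (∣∣²-cong z≈w)

  -- The parallelogram law with the term `∣z - w∣²` dropped. It serves as the triangle inequality
  -- for squared moduli.
  ∣z+w∣²≲ : ∀ z w → ∣ z + w ∣² ≲ (∣ z ∣² +ᴿ ∣ w ∣²) +ᴿ (∣ z ∣² +ᴿ ∣ w ∣²)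
  ∣z+w∣²≲ z w = 0 , λ n _ →
    let a = seq (re z) n ; b = seq (im z) n ; c = seq (re w) n ; d = seq (im w) n in
    ℚ.≤-trans (p≤p+q (0≤p²+q² (a ℚ.- c) (b ℚ.- d)))
      (ℚ.≤-reflexive (solve 4 (λ a b c d →
        ((a :+ c) :* (a :+ c) :+ (b :+ d) :* (b :+ d)) :+
        ((a :- c) :* (a :- c) :+ (b :- d) :* (b :- d)) :=
        ((a :* a :+ b :* b) :+ (c :* c :+ d :* d)) :+
        ((a :* a :+ b :* b) :+ (c :* c :+ d :* d))) ≡.refl a b c d))
    where open +-*-Solver

  ∣z+w∣²<q : ∀ z w {q} → ∣ z ∣² <ᴿ fromℚ (q ℚ.* ½ ℚ.* ½) → ∣ w ∣² <ᴿ fromℚ (q ℚ.* ½ ℚ.* ½) →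
             ∣ z + w ∣² <ᴿ fromℚ q
  ∣z+w∣²<q z w {q} z< w< = ≲-<-trans (∣z+w∣²≲ z w)
    (<-≲-trans (+-mono-<ᴿ (+-mono-<ᴿ z< w<) (+-mono-<ᴿ z< w<))
      (0 , λ _ _ → ℚ.≤-reflexive
        (≡.trans (≡.cong₂ ℚ._+_ (halves (q ℚ.* ½)) (halves (q ℚ.* ½))) (halves q))))

  -- By `∣cz∣² = ∣c∣²∣z∣²`, where the rational `B` eventually bounds the terms of `∣c∣²`. The gap in
  -- the bound on `∣z∣²`, multiplied by `B`, is the new gap.
  *-bounded : ∀ c → ∃[ B ] ∃ λ (0<B : 0ℚ ℚ.< B) →
    ∀ z q → ∣ z ∣² <ᴿ fromℚ (Rat.inv B 0<B ℚ.* q) → ∣ c * z ∣² <ᴿ fromℚ q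
  *-bounded c with bounded ∣ c ∣²
  ... | B , 0<B , c<B = B , 0<B , λ z q z< →
    mk< (B ℚ.* gap z<) (0<* 0<B (0<gap z<)) (both (λ n c<B z≤ →
      let a = seq (re c) n ; b = seq (im c) n ; x = seq (re z) n ; y = seq (im z) n in begin
        seq ∣ c * z ∣² n ℚ.+ B ℚ.* gap z<
          ≡⟨ ≡.cong (ℚ._+ B ℚ.* gap z<) (solve 4 (λ a b x y →
               (a :* x :+ :- (b :* y)) :* (a :* x :+ :- (b :* y)) :+
               (a :* y :+ b :* x) :* (a :* y :+ b :* x) :=
               (a :* a :+ b :* b) :* (x :* x :+ y :* y)) ≡.refl a b x y) ⟩
        seq ∣ c ∣² n ℚ.* seq ∣ z ∣² n ℚ.+ B ℚ.* gap z<
          ≤⟨ ℚ.+-monoˡ-≤ (B ℚ.* gap z<) (ℚ.*-monoʳ-≤-nonNeg (seq ∣ z ∣² n)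
               {{ℚ.nonNegative (0≤p²+q² x y)}}
               (ℚ.≤-trans (p≤∣p∣ (seq ∣ c ∣² n)) (ℚ.<⇒≤ c<B))) ⟩
        B ℚ.* seq ∣ z ∣² n ℚ.+ B ℚ.* gap z<
          ≡⟨ ≡.sym (ℚ.*-distribˡ-+ B (seq ∣ z ∣² n) (gap z<)) ⟩
        B ℚ.* (seq ∣ z ∣² n ℚ.+ gap z<)
          ≤⟨ ℚ.*-monoˡ-≤-nonNeg B {{ℚ.nonNegative (ℚ.<⇒≤ 0<B)}} z≤ ⟩
        B ℚ.* (Rat.inv B 0<B ℚ.* q)
          ≡⟨ ≡.sym (ℚ.*-assoc B (Rat.inv B 0<B) q) ⟩
        B ℚ.* Rat.inv B 0<B ℚ.* q
          ≡⟨ ≡.cong (ℚ._* q) (Rat.inv-inverse B 0<B) ⟩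
        1ℚ ℚ.* q
          ≡⟨ ℚ.*-identityˡ q ⟩
        q ∎)
      c<B (separated z<))
    where
    open +-*-Solver
    open ℚ.≤-Reasoning

  ∣z∣²<ε⇒z≈0 : ∀ {z} → (∀ q → 0ℚ ℚ.< q → ∣ z ∣² <ᴿ fromℚ q) → z ≈ 0#
  ∣z∣²<ε⇒z≈0 {z} z< = Complex.mk≈
    (close-0 (re z) λ n → p≤p+q (0≤p*p (seq (im z) n)))
    (close-0 (im z) λ n → ℚ.≤-trans (p≤p+q (0≤p*p (seq (re z) n)))
      (ℚ.≤-reflexive (ℚ.+-comm (seq (im z) n ℚ.* seq (im z) n) (seq (re z) n ℚ.* seq (re z) n))))
    where
    close-0 : ∀ x → (∀ n → seq x n ℚ.* seq x n ℚ.≤ seq ∣ z ∣² n) → x ≈ᴿ 0ℝ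
    -- The bound is taken at `ε²`, since it controls the square of the coordinate.
    close-0 x x²≤ .close ε 0<ε with z< (ε ℚ.* ε) (0<* 0<ε 0<ε)
    ... | mk< g 0<g (N , s) = N , λ n n≥ →
      ≡.subst (λ a → ℚ.∣ a ∣ ℚ.< ε) (≡.sym (ℚ.+-identityʳ (seq x n)))
        (p²<q²⇒∣p∣<q 0<ε (ℚ.≤-<-trans (x²≤ n) (ℚ.<-≤-trans
          (≡.subst (ℚ._< seq ∣ z ∣² n ℚ.+ g) (ℚ.+-identityʳ (seq ∣ z ∣² n))
            (ℚ.+-monoʳ-< (seq ∣ z ∣² n) 0<g))
          (s n n≥))))

  -- Tightness of apartness: for each `q`, cotransitivity offers `0 < ∣z∣²`, which is refuted, or
  -- `∣z∣² < q`.
  ¬≠0⇒≈0 : ∀ {z} → ¬ z ≠0 → z ≈ 0#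
  ¬≠0⇒≈0 {z} z≯0 = ∣z∣²<ε⇒z≈0 λ q 0<q → below q (<-cotrans ∣ z ∣² 0<q)
    where
    below : ∀ q → 0ℝ <ᴿ ∣ z ∣² ⊎ ∣ z ∣² <ᴿ fromℚ q → ∣ z ∣² <ᴿ fromℚ q
    below q (inj₁ z>0) = ⊥-elim (z≯0 z>0)
    below q (inj₂ z<q) = z<q

  ∣0∣²<q : ∀ {q} → 0ℚ ℚ.< q → ∣ 0# ∣² <ᴿ fromℚ q
  ∣0∣²<q 0<q = ≲-<-trans (0 , λ _ _ → ℚ.≤-refl) (fromℚ-mono-< 0<q)

  ≈0⇒¬≠0 : ∀ {z} → z ≈ 0# → ¬ z ≠0
  ≈0⇒¬≠0 z≈0 z≠0 = ℚ.<-irrefl ≡.refl (fromℚ-cancel-< (≲-<-trans (0<⇒fromℚ≲ z≠0)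
    (∣z∣²<q-resp-≈ (C.sym z≈0) (∣0∣²<q (0<gap z≠0)))))

-- Ring identities over ℂ

module ℂ-Solver where

  open +-*-Solver using () renaming (solve to solveℚ; _:+_ to _⊞_; _:*_ to _⊠_; :-_ to ⊟_;
    _:=_ to _≐_; con to κ)

  -- Cancelling terms requires recognising zero coefficients, which is decidable in ℚ but not in ℂ.
  -- The constants `con 0ℚ` and `con 1ℚ` denote `0#` and `1#` definitionally.
  fromℚ-morphism : ℚ.+-*-rawRing ACR.-Raw-AlmostCommutative⟶
                   ACR.fromCommutativeRing ℂ-commutativeRing
  fromℚ-morphism = record
    { ⟦_⟧    = λ q → fromℝ (fromℚ q)
    ; +-homo = λ _ _ → Complex.mk≈ (≗⇒≈ λ _ → ≡.refl) (≗⇒≈ λ _ → ≡.refl)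
    ; *-homo = λ p q → Complex.mk≈
        (≗⇒≈ λ _ → solveℚ 2 (λ p q → p ⊠ q ≐ p ⊠ q ⊞ ⊟ (κ 0ℚ ⊠ κ 0ℚ)) ≡.refl p q)
        (≗⇒≈ λ _ → solveℚ 2 (λ p q → κ 0ℚ ≐ p ⊠ κ 0ℚ ⊞ κ 0ℚ ⊠ q) ≡.refl p q)
    ; -‿homo = λ _ → Complex.mk≈ (≗⇒≈ λ _ → ≡.refl) (≗⇒≈ λ _ → ≡.refl)
    ; 0-homo = C.refl
    ; 1-homo = C.refl
    }

  coefficient-≟ : WeaklyDecidable (ACR.Induced-equivalence fromℚ-morphism)
  coefficient-≟ p q with p ℚ.≟ q
  ... | yes ≡.refl = just C.refl
  ... | no  _      = nothing

  open RingSolver ℚ.+-*-rawRing (ACR.fromCommutativeRing ℂ-commutativeRing)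
    fromℚ-morphism coefficient-≟ public

open ℂ-Solver using (solve; _:=_; _:+_; _:*_; _:-_; :-_; con)
open SemiringSum C.semiring using (sum-cong-≋; *-distribˡ-sum; *-distribʳ-sum)
open SetoidReasoning ℂ-setoid

z-0≈z : ∀ z → z - 0# ≈ z
z-0≈z = solve 1 (λ z → z :- con 0ℚ := z) C.refl

-- Limits at 0

Function₀ : Set
Function₀ = (h : ℂ) → h ≠0 → ℂ

-- Limit₀ with rational bounds on squared moduli, which avoids square roots.
-- Being a record, it lets φ and L be inferred.
infix 4 _⟶₀_
record _⟶₀_ (φ : Function₀) (L : ℂ) : Set where
  constructor mk⟶₀
  field
    bound : ∀ q → 0ℚ ℚ.< q → ∃[ r ] 0ℚ ℚ.< r ×
            (∀ h (h≠0 : h ≠0) → ∣ h ∣² <ᴿ fromℚ r → ∣ φ h h≠0 - L ∣² <ᴿ fromℚ q)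
open _⟶₀_

abstract

  -- `Limit₀` bounds squared moduli by `ε²` and `δ²`. Choosing `ε = t` with `t² < q` handles the
  -- values, and the square of the rational gap below `δ` is a radius for `∣h∣²`.
  fromLimit₀ : ∀ {φ L} → Limit₀ φ L → φ ⟶₀ L
  fromLimit₀ lim .bound q 0<q =
    let t , 0<t , t²<q = square-below q 0<q
        δ , 0<δ , c    = lim (fromℚ t) (fromℚ-mono-< 0<t) in
    gap 0<δ ℚ.* gap 0<δ , 0<* (0<gap 0<δ) (0<gap 0<δ) , λ h h≠0 h< →
    <-≲-trans (c h h≠0 (∣z∣²<q-resp-≈ (C.sym (z-0≈z h)) (<-≲-trans h< (0<⇒gap²≲ 0<δ))))
      (0 , λ _ _ → ℚ.<⇒≤ t²<q)

  toLimit₀ : ∀ {φ L} → φ ⟶₀ L → Limit₀ φ L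
  toLimit₀ φ→L ε 0<ε =
    let r , 0<r , c    = bound φ→L (gap 0<ε ℚ.* gap 0<ε) (0<* (0<gap 0<ε) (0<gap 0<ε))
        t , 0<t , t²<r = square-below r 0<r in
    fromℚ t , fromℚ-mono-< 0<t , λ h h≠0 h< →
    <-≲-trans (c h h≠0 (<-≲-trans (∣z∣²<q-resp-≈ (z-0≈z h) h<) (0 , λ _ _ → ℚ.<⇒≤ t²<r)))
      (0<⇒gap²≲ 0<ε)

  ⟶₀-cong : ∀ {φ ψ L M} → (∀ h h≠0 → φ h h≠0 ≈ ψ h h≠0) → L ≈ M → φ ⟶₀ L → ψ ⟶₀ M
  ⟶₀-cong φ≈ψ L≈M φ→L .bound q 0<q =
    let r , 0<r , c = bound φ→L q 0<q in
    r , 0<r , λ h h≠0 h< →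
    ∣z∣²<q-resp-≈ (C.+-cong (φ≈ψ h h≠0) (C.-‿cong L≈M)) (c h h≠0 h<)

  ⟶₀-+ : ∀ {φ ψ L M} → φ ⟶₀ L → ψ ⟶₀ M → (λ h h≠0 → φ h h≠0 + ψ h h≠0) ⟶₀ L + M
  ⟶₀-+ {φ} {ψ} {L} {M} φ→L ψ→M .bound q 0<q =
    let r , 0<r , c = bound φ→L (q ℚ.* ½ ℚ.* ½) (½ε (½ε 0<q))
        s , 0<s , d = bound ψ→M (q ℚ.* ½ ℚ.* ½) (½ε (½ε 0<q)) in
    r ℚ.⊓ s , 0<⊓ 0<r 0<s , λ h h≠0 h< → ∣z∣²<q-resp-≈
      (solve 4 (λ a L b M → (a :- L) :+ (b :- M) := (a :+ b) :- (L :+ M))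
        C.refl (φ h h≠0) L (ψ h h≠0) M)
      (∣z+w∣²<q (φ h h≠0 - L) (ψ h h≠0 - M)
        (c h h≠0 (<-≲-trans h< (0 , λ _ _ → ℚ.p⊓q≤p r s)))
        (d h h≠0 (<-≲-trans h< (0 , λ _ _ → ℚ.p⊓q≤q r s))))

  ⟶₀-*ˡ : ∀ c {φ L} → φ ⟶₀ L → (λ h h≠0 → c * φ h h≠0) ⟶₀ c * L
  ⟶₀-*ˡ c {φ} {L} φ→L .bound q 0<q =
    let B , 0<B , b = *-bounded c
        r , 0<r , d = bound φ→L (Rat.inv B 0<B ℚ.* q) (0<* (Rat.0<inv B 0<B) 0<q) in
    r , 0<r , λ h h≠0 h< → ∣z∣²<q-resp-≈
      (solve 3 (λ c a L → c :* (a :- L) := c :* a :- c :* L) C.refl c (φ h h≠0) L)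
      (b (φ h h≠0 - L) q (d h h≠0 h<))

  ⟶₀-0 : (λ _ _ → 0#) ⟶₀ 0#
  ⟶₀-0 .bound q 0<q = 1ℚ , ℚ.positive⁻¹ 1ℚ , λ _ _ _ →
    ∣z∣²<q-resp-≈ (C.sym (z-0≈z 0#)) (∣0∣²<q 0<q)

  -- Every punctured neighbourhood of 0 contains a point at which to read off the bound: the real
  -- number `t` with `t² < r`. Uniqueness of limits rests on this.
  ⟶₀-constant : ∀ {z L} → (λ _ _ → z) ⟶₀ L → z - L ≈ 0#
  ⟶₀-constant {z} {L} z→L = ∣z∣²<ε⇒z≈0 λ q 0<q →
    let r , 0<r , c    = bound z→L q 0<q
        t , 0<t , t²<r = square-below r 0<r
        t²≡            = ℚ.+-identityʳ (t ℚ.* t) in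
    c (fromℝ (fromℚ t))
      (<-≲-trans (fromℚ-mono-< (0<* 0<t 0<t)) (0 , λ _ _ → ℚ.≤-reflexive (≡.sym t²≡)))
      (≲-<-trans (0 , λ _ _ → ℚ.≤-reflexive t²≡) (fromℚ-mono-< t²<r))

⟶₀-- : ∀ {φ ψ L M} → φ ⟶₀ L → ψ ⟶₀ M → (λ h h≠0 → φ h h≠0 - ψ h h≠0) ⟶₀ L - M
⟶₀-- {φ} {ψ} {L} {M} φ→L ψ→M = ⟶₀-cong
  (λ h h≠0 → solve 2 (λ a b → a :+ (:- con 1ℚ) :* b := a :- b) C.refl (φ h h≠0) (ψ h h≠0))
  (solve 2 (λ a b → a :+ (:- con 1ℚ) :* b := a :- b) C.refl L M)
  (⟶₀-+ φ→L (⟶₀-*ˡ (- 1#) ψ→M))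

⟶₀-unique : ∀ {φ L M} → φ ⟶₀ L → φ ⟶₀ M → L ≈ M
⟶₀-unique {φ} {L} {M} φ→L φ→M = begin
  L                     ≈⟨ solve 2 (λ L M → L := (con 0ℚ :- (M :- L)) :+ M) C.refl L M ⟩
  (0# - (M - L)) + M    ≈⟨ C.+-congʳ (⟶₀-constant (⟶₀-cong
                             (λ h h≠0 → C.-‿inverseʳ (φ h h≠0)) C.refl (⟶₀-- φ→M φ→L))) ⟩
  0# + M                ≈⟨ C.+-identityˡ M ⟩
  M                     ∎

⟶₀-∑ : ∀ {n} {φ : Fin n → Function₀} {L : Fin n → ℂ} → (∀ m → φ m ⟶₀ L m) →
       (λ h h≠0 → ∑ (λ m → φ m h h≠0)) ⟶₀ ∑ L
⟶₀-∑ {zero}  _   = ⟶₀-0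
⟶₀-∑ {suc n} φ→L = ⟶₀-+ (φ→L zero) (⟶₀-∑ λ m → φ→L (suc m))

-- Dividing by `h` sends every `v` term to 0, so only the `u` term can carry the limit. The limit is
-- that of `u(h)/h` times `a`; nothing is claimed about `u(h)/h` alone, which matters when `a` may
-- be 0. It is applied both to `f` and to its fractional sum.
⟶₀-principal : ∀ {n} {φ u : ℂ → ℂ} {v : Fin n → ℂ → ℂ} {a L : ℂ} {c : Fin n → ℂ} →
  (∀ m → (λ h h≠0 → v m h / h [ h≠0 ]) ⟶₀ 0#) →
  (∀ h → φ h ≈ u h * a + ∑ (λ m → v m h * c m)) →
  (λ h h≠0 → φ h / h [ h≠0 ]) ⟶₀ L →
  (λ h h≠0 → u h / h [ h≠0 ] * a) ⟶₀ L
⟶₀-principal {n} {φ} {u} {v} {a} {L} {c} v/h→0 φ≈ φ/h→L = ⟶₀-cong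
  quotient
  (C.trans (C.+-congˡ (C.-‿cong ∑c0≈0)) (z-0≈z L))
  (⟶₀-- φ/h→L (⟶₀-∑ λ m → ⟶₀-*ˡ (c m) (v/h→0 m)))
  where
  ∑c0≈0 : ∑ (λ m → c m * 0#) ≈ 0#
  ∑c0≈0 = C.trans (sum-cong-≋ {n} (λ m → C.*-comm (c m) 0#))
    (C.trans (C.sym (*-distribˡ-sum 0# c)) (C.zeroˡ (∑ c)))
  quotient : ∀ h h≠0 → φ h / h [ h≠0 ] - ∑ (λ m → c m * (v m h / h [ h≠0 ])) ≈
                       u h / h [ h≠0 ] * a
  quotient h h≠0 = begin
    φ h * i - ∑ (λ m → c m * (v m h * i))
      ≈⟨ C.+-cong (C.*-congʳ (φ≈ h)) (C.-‿cong (sum-cong-≋ {n} λ m →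
           solve 3 (λ c v i → c :* (v :* i) := v :* c :* i) C.refl (c m) (v m h) i)) ⟩
    (u h * a + s) * i - ∑ (λ m → v m h * c m * i)
      ≈⟨ C.+-congˡ (C.-‿cong (C.sym (*-distribʳ-sum i (λ m → v m h * c m)))) ⟩
    (u h * a + s) * i - s * i
      ≈⟨ solve 4 (λ u a s i → (u :* a :+ s) :* i :- s :* i := u :* i :* a) C.refl (u h) a s i ⟩
    u h * i * a ∎
    where
    i s : ℂ
    i = recip h h≠0
    s = ∑ (λ m → v m h * c m)

-- Fractional sums

abstract

  -- Opaque, since comparing the proofs of membership of combinations is slow.
  ∑ˢ : ∀ {𝒰 n} → (Fin n → ℂ) → (Fin n → ∃ (𝐒 𝒰)) → ∃ (𝐒 𝒰)
  ∑ˢ {n = zero}  a g = record { to = λ _ → 0# ; cong = λ _ → C.refl } , [] , λ _ → C.refl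
  ∑ˢ {n = suc n} a g = combineˢ (a zero) (g zero) 1# (∑ˢ (λ m → a (suc m)) (λ m → g (suc m)))

  ∑ˢ-correct : ∀ {𝒰 n} (a : Fin n → ℂ) (g : Fin n → ∃ (𝐒 𝒰)) x →
               proj₁ (∑ˢ a g) ⟨$⟩ x ≈ ∑ (λ m → a m * (proj₁ (g m) ⟨$⟩ x))
  ∑ˢ-correct {n = zero}  a g x = C.refl
  ∑ˢ-correct {n = suc n} a g x = C.+-congˡ (C.trans (C.*-identityˡ _)
    (∑ˢ-correct (λ m → a (suc m)) (λ m → g (suc m)) x))

module FractionalSum {𝒰 : Pred ℂ^ℂ 0ℓ} {F : SumMap 𝒰} (isFractionalSum : IsFractionalSum F) where

  open IsFractionalSum isFractionalSum

  sum-cong : ∀ f g {x y x′ y′} → (∀ t → proj₁ f ⟨$⟩ t ≈ proj₁ g ⟨$⟩ t) → x ≈ x′ → y ≈ y′ →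
             F ⟪ f ∶ x ⋯ y ⟫ ≈ F ⟪ g ∶ x′ ⋯ y′ ⟫
  sum-cong _ _ f≈g x≈x′ y≈y′ = Func.cong F (f≈g , x≈x′ , y≈y′)

  sum-cong-bounds : ∀ f {x y x′ y′} → x ≈ x′ → y ≈ y′ → F ⟪ f ∶ x ⋯ y ⟫ ≈ F ⟪ f ∶ x′ ⋯ y′ ⟫
  sum-cong-bounds f = sum-cong f f λ _ → C.refl

  -- The combination may come with any proof of membership, because sums depend only on values. This
  -- makes linearity applicable to the opaque `∑ˢ`.
  sum-linear : ∀ a f b g k → (∀ t → proj₁ k ⟨$⟩ t ≈ a * (proj₁ f ⟨$⟩ t) + b * (proj₁ g ⟨$⟩ t)) →
               ∀ x y → F ⟪ k ∶ x ⋯ y ⟫ ≈ a * F ⟪ f ∶ x ⋯ y ⟫ + b * F ⟪ g ∶ x ⋯ y ⟫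
  sum-linear a f b g k k≈ x y = C.trans k≈combine (linear a f b g x y)
    where
    k≈combine : F ⟪ k ∶ x ⋯ y ⟫ ≈ F ⟪ combineˢ a f b g ∶ x ⋯ y ⟫
    k≈combine = sum-cong k (combineˢ a f b g) k≈ C.refl C.refl

  -- A null function agrees with `0f + 0f`, so linearity with both coefficients 0 applies.
  sum-zero : ∀ f → (∀ t → proj₁ f ⟨$⟩ t ≈ 0#) → ∀ x y → F ⟪ f ∶ x ⋯ y ⟫ ≈ 0#
  sum-zero f f≈0 x y = C.trans
    (sum-linear 0# f 0# f f (λ t → C.trans (f≈0 t) (C.sym (0a+0a≈0 (proj₁ f ⟨$⟩ t)))) x y)
    (0a+0a≈0 (F ⟪ f ∶ x ⋯ y ⟫))
    where
    0a+0a≈0 : ∀ a → 0# * a + 0# * a ≈ 0#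
    0a+0a≈0 a = C.trans (C.+-cong (C.zeroˡ a) (C.zeroˡ a)) (C.+-identityʳ 0#)

  sum-∑ˢ : ∀ {n} (a : Fin n → ℂ) (g : Fin n → ∃ (𝐒 𝒰)) x y →
           F ⟪ ∑ˢ a g ∶ x ⋯ y ⟫ ≈ ∑ (λ m → a m * F ⟪ g m ∶ x ⋯ y ⟫)
  sum-∑ˢ {zero}  a g x y = sum-zero (∑ˢ a g) (∑ˢ-correct a g) x y
  sum-∑ˢ {suc n} a g x y = C.trans
    (sum-linear (a zero) (g zero) 1# tail (∑ˢ a g)
      (λ t → C.trans (∑ˢ-correct a g t) (C.+-congˡ (C.sym (C.trans (C.*-identityˡ _)
        (∑ˢ-correct (λ m → a (suc m)) (λ m → g (suc m)) t))))) x y)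
    (C.+-congˡ (C.trans (C.*-identityˡ _) (sum-∑ˢ (λ m → a (suc m)) (λ m → g (suc m)) x y)))
    where
    tail : ∃ (𝐒 𝒰)
    tail = ∑ˢ (λ m → a (suc m)) (λ m → g (suc m))

  -- Continued summation with bounds `1`, `0`, `0` reads `e + e = e`, as `0 + 1 = 1`.
  sum-empty : ∀ f → F ⟪ f ∶ 1# ⋯ 0# ⟫ ≈ 0#
  sum-empty f = begin
    e            ≈⟨ solve 1 (λ e → e := (e :+ e) :- e) C.refl e ⟩
    (e + e) - e  ≈⟨ C.+-congʳ (C.trans
                      (C.+-congˡ (sum-cong-bounds f (C.sym (C.+-identityˡ 1#)) C.refl))
                      (continued f 1# 0# 0#)) ⟩
    e - e        ≈⟨ C.-‿inverseʳ e ⟩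
    0#           ∎
    where
    e : ℂ
    e = F ⟪ f ∶ 1# ⋯ 0# ⟫

  -- Continued summation cuts the range at `h`; the remainder, from `h + 1` to `x + h`, is moved
  -- back by `h` to the range from `1` to `x`.
  sum-split : ∀ f g x h → (∀ t → proj₁ f ⟨$⟩ (t + h) ≈ proj₁ g ⟨$⟩ t) →
    F ⟪ f ∶ 1# ⋯ x + h ⟫ ≈ F ⟪ f ∶ 1# ⋯ h ⟫ + F ⟪ g ∶ 1# ⋯ x ⟫
  sum-split f g x h shift≈ = C.trans (C.sym (continued f 1# h (x + h)))
    (C.+-congˡ (C.trans (sum-cong-bounds f (C.+-comm h 1#) C.refl)
      (C.trans (shifted f 1# x h) shift-f≈g)))
    where
    shift-f≈g : F ⟪ shiftˢ h f ∶ 1# ⋯ x ⟫ ≈ F ⟪ g ∶ 1# ⋯ x ⟫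
    shift-f≈g = sum-cong (shiftˢ h f) g shift≈ C.refl C.refl

  -- For fixed `h` the hypothesis presents the translate of `f` by `h` as a linear combination of
  -- `f`, `f′` and the `w m`, with coefficients constant in the summation variable. It can therefore
  -- be summed term by term, and splitting at `h` produces the extra term `F ⟪ f ∶ 1# ⋯ h ⟫`.
  sum-increment : ∀ {n} (f f′ : ∃ (𝐒 𝒰)) (u : ℂ → ℂ) (v : Fin n → ℂ → ℂ) (w : Fin n → ∃ (𝐒 𝒰)) →
    (∀ x h → (proj₁ f ⟨$⟩ (x + h)) - (proj₁ f ⟨$⟩ x) ≈
      u h * (proj₁ f′ ⟨$⟩ x) + ∑ (λ m → v m h * (proj₁ (w m) ⟨$⟩ x))) →
    ∀ x h → F ⟪ f ∶ 1# ⋯ x + h ⟫ - F ⟪ f ∶ 1# ⋯ x ⟫ - F ⟪ f ∶ 1# ⋯ h ⟫ ≈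
      u h * F ⟪ f′ ∶ 1# ⋯ x ⟫ + ∑ (λ m → v m h * F ⟪ w m ∶ 1# ⋯ x ⟫)
  sum-increment {n} f f′ u v w f-increment x h = begin
    F ⟪ f ∶ 1# ⋯ x + h ⟫ - T - S
      ≈⟨ C.+-congʳ (C.+-congʳ (C.trans (sum-split f g x h shift≈) (C.+-congˡ (sum-∑ˢ a k 1# x)))) ⟩
    S + (1# * T + d) - T - S
      ≈⟨ solve 3 (λ S T d → S :+ (con 1ℚ :* T :+ d) :- T :- S := d) C.refl S T d ⟩
    d ∎
    where
    S T d : ℂ
    S = F ⟪ f ∶ 1# ⋯ h ⟫
    T = F ⟪ f ∶ 1# ⋯ x ⟫
    d = u h * F ⟪ f′ ∶ 1# ⋯ x ⟫ + ∑ (λ m → v m h * F ⟪ w m ∶ 1# ⋯ x ⟫)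
    a : Fin (suc (suc n)) → ℂ
    a zero          = 1#
    a (suc zero)    = u h
    a (suc (suc m)) = v m h
    k : Fin (suc (suc n)) → ∃ (𝐒 𝒰)
    k zero          = f
    k (suc zero)    = f′
    k (suc (suc m)) = w m
    g : ∃ (𝐒 𝒰)
    g = ∑ˢ a k
    shift≈ : ∀ t → proj₁ f ⟨$⟩ (t + h) ≈ proj₁ g ⟨$⟩ t
    shift≈ t = begin
      f⟨t+h⟩
        ≈⟨ solve 2 (λ a b → a := con 1ℚ :* b :+ (a :- b)) C.refl f⟨t+h⟩ f⟨t⟩ ⟩
      1# * f⟨t⟩ + (f⟨t+h⟩ - f⟨t⟩)
        ≈⟨ C.+-congˡ (f-increment t h) ⟩
      -- The first two summands unfold definitionally to `1# * f⟨t⟩` and the `u h` term.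
      ∑ (λ m → a m * (proj₁ (k m) ⟨$⟩ t))
        ≈⟨ ∑ˢ-correct a k t ⟨
      proj₁ g ⟨$⟩ t ∎
      where
      f⟨t⟩ f⟨t+h⟩ : ℂ
      f⟨t⟩   = proj₁ f ⟨$⟩ t
      f⟨t+h⟩ = proj₁ f ⟨$⟩ (t + h)

-- The derivative of the fractional sum

≠0-cancelˡ : ∀ {z w} → z ≠0 → z * w ≈ 0# → w ≈ 0#
≠0-cancelˡ {z} {w} z≠0 zw≈0 = begin
  w                      ≈⟨ C.*-identityˡ w ⟨
  1# * w                 ≈⟨ C.*-congʳ (Complex.recip-inverse z z≠0) ⟨
  z * recip z z≠0 * w    ≈⟨ solve 3 (λ z i w → z :* i :* w := i :* (z :* w)) C.refl z _ w ⟩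
  recip z z≠0 * (z * w)  ≈⟨ C.*-congˡ zw≈0 ⟩
  recip z z≠0 * 0#       ≈⟨ C.zeroʳ _ ⟩
  0#                     ∎

theorem4p3p1 : (f f′ : ℂ^ℂ) →
    (∀ x → HasDerivativeAt (f ⟨$⟩_) x (f′ ⟨$⟩ x)) →
    (n : ℕ) (u : ℂ^ℂ) (v w : Fin n → ℂ^ℂ) →
    (∀ m → Limit₀ (λ h h≠0 → (v m ⟨$⟩ h) / h [ h≠0 ]) 0#) →
    (∀ x h → (f ⟨$⟩ (x + h)) - (f ⟨$⟩ x) ≈
    (u ⟨$⟩ h) * (f′ ⟨$⟩ x) + ∑ (λ m → (v m ⟨$⟩ h) * (w m ⟨$⟩ x))) →
    (𝒰 : Pred ℂ^ℂ 0ℓ) (U : Summable 𝒰) →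
    (f∈ : f ∈ 𝐒 𝒰) (f′∈ : f′ ∈ 𝐒 𝒰) → (∀ m → w m ∈ 𝐒 𝒰) →
    ∃[ essf ] IsEssence U (f , f∈) essf ×
    (∀ x → HasDerivativeAt (λ y → fractionalSum U ⟪ (f , f∈) ∶ 1# ⋯ y ⟫) x
    (essf + fractionalSum U ⟪ (f′ , f′∈) ∶ 1# ⋯ x ⟫))
theorem4p3p1 f f′ f-derivative n u v w v/h→0 f-increment 𝒰 U f∈ f′∈ w∈ =
  E , toLimit₀ essence , λ x → toLimit₀ (⟶₀-cong (λ _ _ → C.refl) (D≈E+X x) (T-derivative x))
  where
  open Summable U using (isFractionalSum)
  open FractionalSum isFractionalSum

  T X : ℂ → ℂ
  T x = fractionalSum U ⟪ (f , f∈) ∶ 1# ⋯ x ⟫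
  X x = fractionalSum U ⟪ (f′ , f′∈) ∶ 1# ⋯ x ⟫

  T-holomorphic : Holomorphic T
  T-holomorphic = IsFractionalSum.holomorphic isFractionalSum (f , f∈)
    λ z → f′ ⟨$⟩ z , f-derivative z

  E : ℂ
  E = proj₁ (T-holomorphic 0#)

  T-derivative : ∀ x → (λ h h≠0 → (T (x + h) - T x) / h [ h≠0 ]) ⟶₀ proj₁ (T-holomorphic x)
  T-derivative x = fromLimit₀ (proj₂ (T-holomorphic x))

  v/h⟶₀0 : ∀ m → (λ h h≠0 → (v m ⟨$⟩ h) / h [ h≠0 ]) ⟶₀ 0#
  v/h⟶₀0 m = fromLimit₀ (v/h→0 m)

  essence : (λ h h≠0 → 1# / h [ h≠0 ] * T h) ⟶₀ E
  essence = ⟶₀-cong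
    (λ h h≠0 → begin
      (T (0# + h) - T 0#) * recip h h≠0
        ≈⟨ C.*-congʳ (C.+-cong (sum-cong-bounds (f , f∈) C.refl (C.+-identityˡ h))
             (C.-‿cong (sum-empty (f , f∈)))) ⟩
      (T h - 0#) * recip h h≠0
        ≈⟨ solve 2 (λ t i → (t :- con 0ℚ) :* i := con 1ℚ :* i :* t) C.refl (T h) (recip h h≠0) ⟩
      1# * recip h h≠0 * T h ∎)
    C.refl (T-derivative 0#)

  module _ (x : ℂ) where

    D Z : ℂ
    D = proj₁ (T-holomorphic x)
    Z = D - E - X x

    u/h*X→D-E : (λ h h≠0 → (u ⟨$⟩ h) / h [ h≠0 ] * X x) ⟶₀ (D - E)
    u/h*X→D-E = ⟶₀-principal v/h⟶₀0
      (sum-increment (f , f∈) (f′ , f′∈) (u ⟨$⟩_) (λ m → v m ⟨$⟩_) (λ m → w m , w∈ m) f-increment x)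
      -- The difference quotient of `T` at `x` minus the quotient defining the essence is the
      -- increment of `sum-increment` over `h`.
      (⟶₀-cong
        (λ h h≠0 → solve 4 (λ a b c i → (a :- b) :* i :- con 1ℚ :* i :* c := (a :- b :- c) :* i)
          C.refl (T (x + h)) (T x) (T h) (recip h h≠0))
        C.refl (⟶₀-- (T-derivative x) essence))

    u/h*f′→f′ : ∀ y → (λ h h≠0 → (u ⟨$⟩ h) / h [ h≠0 ] * (f′ ⟨$⟩ y)) ⟶₀ (f′ ⟨$⟩ y)
    u/h*f′→f′ y = ⟶₀-principal v/h⟶₀0 (f-increment y) (fromLimit₀ (f-derivative y))

    -- The product of `u(h)/h`, `X x` and `f′(y)` has two limits: grouping `u(h)/h` with `X x` gives
    -- `f′(y) (D - E)`, grouping it with `f′(y)` gives `X x f′(y)`. Uniqueness equates them.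
    Z*f′≈0 : ∀ y → Z * (f′ ⟨$⟩ y) ≈ 0#
    Z*f′≈0 y = begin
      (D - E - X x) * a
        ≈⟨ solve 3 (λ d X a → (d :- X) :* a := a :* d :- X :* a) C.refl (D - E) (X x) a ⟩
      a * (D - E) - X x * a
        ≈⟨ C.+-congʳ (⟶₀-unique (⟶₀-*ˡ a u/h*X→D-E)
             (⟶₀-cong
               (λ h h≠0 → solve 3 (λ k X a → X :* (k :* a) := a :* (k :* X))
                 C.refl ((u ⟨$⟩ h) / h [ h≠0 ]) (X x) a)
               C.refl (⟶₀-*ˡ (X x) (u/h*f′→f′ y)))) ⟩
      X x * a - X x * a
        ≈⟨ C.-‿inverseʳ (X x * a) ⟩
      0# ∎
      where
      a : ℂ
      a = f′ ⟨$⟩ y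

    ¬Z≠0 : ¬ Z ≠0
    ¬Z≠0 Z≠0 = ≈0⇒¬≠0 Z≈0 Z≠0
      where
      X≈0 : X x ≈ 0#
      X≈0 = sum-zero (f′ , f′∈) (λ y → ≠0-cancelˡ Z≠0 (Z*f′≈0 y)) 1# x
      -- With `X x` null, the function in `u/h*X→D-E` is identically 0, and so is its limit.
      D-E≈0 : D - E ≈ 0#
      D-E≈0 = ⟶₀-unique u/h*X→D-E (⟶₀-cong
        (λ h h≠0 → C.sym (C.trans (C.*-congˡ X≈0) (C.zeroʳ _))) C.refl ⟶₀-0)
      Z≈0 : Z ≈ 0#
      Z≈0 = C.trans (C.+-cong D-E≈0 (C.-‿cong X≈0)) (z-0≈z 0#)

    D≈E+X : D ≈ E + X x
    D≈E+X = begin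
      D              ≈⟨ solve 3 (λ D E X → D := (D :- E :- X) :+ (E :+ X)) C.refl D E (X x) ⟩
      Z + (E + X x)  ≈⟨ C.+-congʳ (¬≠0⇒≈0 ¬Z≠0) ⟩
      0# + (E + X x) ≈⟨ C.+-identityˡ _ ⟩
      E + X x        ∎
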